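{- Let $d\ge2$ be an integer and let $f:\mathbb{N}\to\mathbb{N}$ be a function of subexponential growth. Then every continuous graph parameter $\zeta:\mathrm{Graph}_d^f\to\mathbb{R}$ is testable.
   Context: $\mathrm{Graph}_d$ is the set of finite simple graphs (up to isomorphism) in which every vertex has degree at most $d$. For a vertex $x$ of a graph, $B_r(x)$ is the ball of radius $r$ around $x$ (the vertices at graph distance at most $r$ from $x$ with the induced graph structure, rooted at $x$). A function $f:\mathbb{N}\to\mathbb{N}$ has subexponential growth if for every $\delta>0$ there is $C_\delta>0$ such that $f(n)\le C_\delta(1+\delta)^n$ for all $n\ge1$. $\mathrm{Graph}_d^f$ is the class of graphs $G\in\mathrm{Graph}_d$ such that $|B_r(x)|\le f(r)$ for each $x\in V(G)$ and each $r\ge 1$. For $r\ge1$, $U^{r,d}$ is the finite set of rooted isomorphism classes of finite simple connected rooted graphs of maximum degree at most $d$ in which every vertex is at distance at most $r$ from the root. For $\alpha\in U^{r,d}$ and $G\in \mathrm{Graph}_d$, $p_G(\alpha)=|T(G,\alpha)|/|V(G)|$, where $T(G,\alpha)$ is the set of $x\in V(G)$ such that $B_r(x)$ is rooted isomorphic to $\alpha$. A sequence $\{G_n\}\subset\mathrm{Graph}_d$ with $|V(G_n)|\to\infty$ is weakly convergent if $\lim_{n\to\infty}p_{G_n}(\alpha)$ exists for every $r\ge1$ and $\alpha\in U^{r,d}$. A graph parameter (a real function invariant under graph isomorphism) $\zeta$ is continuous on $\mathrm{Graph}_d^f$ if $\lim_{n\to\infty}\zeta(G_n)$ exists for every weakly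 convergent sequence $\{G_n\}\subset\mathrm{Graph}_d^f$. Testability: let $\epsilon>0$ and let $N,r,k$ be positive integers (depending on $\zeta$ and $\epsilon$). An $(\epsilon,N,r,k)$-random sampling is the following process: for a graph $G\in\mathrm{Graph}_d^f$ with $|V(G)|\ge N$, pick $k$ vertices of $G$ at random (uniformly and independently); by examining the $r$-neighbourhoods of the chosen vertices one obtains the empirical distribution $Y:\bigcup_{s\le r}U^{s,d}\to\mathbb{R}$, where for $\alpha\in U^{s,d}$, $Y(\alpha)$ is the proportion of the chosen vertices $x$ with $B_s(x)$ rooted isomorphic to $\alpha$. A $(\zeta,\epsilon)$-tester is an algorithm $T$ which takes the empirical distribution $Y$ as its input and calculates a real number $T(Y)$. The parameter $\zeta$ is testable if for every $\epsilon>0$ there exist positive integers $N=N(\zeta,\epsilon)$, $r=r(\zeta,\epsilon)$, $k=k(\zeta,\epsilon)$ and a $(\zeta,\epsilon)$-tester $T$ such that for every $G\in\mathrm{Graph}_d^f$ with $|V(G)|\ge N$, $\mathrm{Prob}(|T(Y)-\zeta(G)|>\epsilon)<\epsilon$. -}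

module Defs where

open import Axiom.ExcludedMiddle using (ExcludedMiddle)
open import Data.Bool.Base using (Bool; true; false; T)
open import Data.Bool.Properties using (T?)
import Data.Bool.Properties as Bool
open import Data.Fin.Base using (Fin; finToFun; funToFin)
import Data.Fin.Properties as Fin
open import Data.Fin.Properties using (any?; all?; finToFun-funToFin)
open import Data.Integer.Base using (+_)
open import Data.List.Base using (List; length; filter; allFin; lookup)
open import Data.List.Membership.Propositional using (_∈_)
open import Data.List.Membership.Propositional.Properties using (∈-filter⁺; ∈-allFin)
open import Data.List.Relation.Unary.Any using (index)
open import Data.Nat.Base as ℕ using (ℕ; zero; suc; _≤_)
import Data.Nat.Properties as ℕ
open import Data.Product.Base using (Σ-syntax; ∃-syntax; _×_; _,_)
open import Data.Rational.Base as ℚ using (ℚ; 0ℚ; 1ℚ; ½)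
import Data.Rational.Properties as ℚ
open import Data.Rational.Solver using (module +-*-Solver)
open import Data.Sum.Base using (inj₁; inj₂)
open import Function.Base using (_∘_)
open import Function.Bundles using (_↔_; mk↔ₛ′; module Inverse)
open import Level using (0ℓ)
open import Relation.Binary.PropositionalEquality
  using (_≡_; refl; sym; trans; cong; cong₂; subst; subst₂)
open import Relation.Nullary.Decidable using (Dec; map′; _×-dec_; _⊎-dec_)
open import Relation.Unary using (Pred; Decidable)

IsCauchy : (ℕ → ℚ) → Set
IsCauchy a = ∀ ε → 0ℚ ℚ.< ε →
  ∃[ N ] (∀ m n → N ≤ m → N ≤ n → ℚ.∣ a m ℚ.- a n ∣ ℚ.< ε)

-- Equality of reals is _≃ℝ_ below.
record ℝ : Set where
  constructor mkℝ
  field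
    seq    : ℕ → ℚ
    cauchy : IsCauchy seq

open ℝ public

private

  half-pos : ∀ {ε} → 0ℚ ℚ.< ε → 0ℚ ℚ.< ½ ℚ.* ε
  half-pos {ε} ε>0 = subst (ℚ._< ½ ℚ.* ε) (ℚ.*-zeroʳ ½) (ℚ.*-monoʳ-<-pos ½ ε>0)

  half+half : ∀ ε → ½ ℚ.* ε ℚ.+ ½ ℚ.* ε ≡ ε
  half+half ε = trans (sym (ℚ.*-distribʳ-+ ε ½ ½)) (ℚ.*-identityˡ ε)

  p≤∣p∣ : ∀ p → p ℚ.≤ ℚ.∣ p ∣
  p≤∣p∣ p with ℚ.≤-total 0ℚ p
  ... | inj₁ 0≤p = ℚ.≤-reflexive (sym (ℚ.0≤p⇒∣p∣≡p 0≤p))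
  ... | inj₂ p≤0 = ℚ.≤-trans p≤0 (ℚ.0≤∣p∣ p)

  ∣p-q∣≡∣q-p∣ : ∀ p q → ℚ.∣ p ℚ.- q ∣ ≡ ℚ.∣ q ℚ.- p ∣
  ∣p-q∣≡∣q-p∣ p q = trans (sym (ℚ.∣-p∣≡∣p∣ (p ℚ.- q))) (cong ℚ.∣_∣
    (solve 2 (λ p q → :- (p :- q) := q :- p) refl p q))
    where open +-*-Solver

  ∣p∣≤∣p-q∣+∣q∣ : ∀ p q → ℚ.∣ p ∣ ℚ.≤ ℚ.∣ p ℚ.- q ∣ ℚ.+ ℚ.∣ q ∣
  ∣p∣≤∣p-q∣+∣q∣ p q = subst (λ t → ℚ.∣ t ∣ ℚ.≤ ℚ.∣ p ℚ.- q ∣ ℚ.+ ℚ.∣ q ∣)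
    (solve 2 (λ p q → (p :- q) :+ q := p) refl p q) (ℚ.∣p+q∣≤∣p∣+∣q∣ (p ℚ.- q) q)
    where open +-*-Solver

  ∣p∣-∣q∣≤∣p-q∣ : ∀ p q → ℚ.∣ p ∣ ℚ.- ℚ.∣ q ∣ ℚ.≤ ℚ.∣ p ℚ.- q ∣
  ∣p∣-∣q∣≤∣p-q∣ p q = subst (ℚ.∣ p ∣ ℚ.- ℚ.∣ q ∣ ℚ.≤_)
    (solve 2 (λ x y → (x :+ y) :- y := x) refl ℚ.∣ p ℚ.- q ∣ ℚ.∣ q ∣)
    (ℚ.+-monoˡ-≤ (ℚ.- ℚ.∣ q ∣) (∣p∣≤∣p-q∣+∣q∣ p q))
    where open +-*-Solver

  ∣∣p∣-∣q∣∣≤∣p-q∣ : ∀ p q → ℚ.∣ ℚ.∣ p ∣ ℚ.- ℚ.∣ q ∣ ∣ ℚ.≤ ℚ.∣ p ℚ.- q ∣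
  ∣∣p∣-∣q∣∣≤∣p-q∣ p q with ℚ.∣p∣≡p∨∣p∣≡-p (ℚ.∣ p ∣ ℚ.- ℚ.∣ q ∣)
  ... | inj₁ eq = subst (ℚ._≤ ℚ.∣ p ℚ.- q ∣) (sym eq) (∣p∣-∣q∣≤∣p-q∣ p q)
  ... | inj₂ eq = subst₂ ℚ._≤_
      (trans (solve 2 (λ x y → y :- x := :- (x :- y)) refl ℚ.∣ p ∣ ℚ.∣ q ∣) (sym eq))
      (∣p-q∣≡∣q-p∣ q p) (∣p∣-∣q∣≤∣p-q∣ q p)
    where open +-*-Solver

  const-cauchy : ∀ q → IsCauchy (λ _ → q)
  const-cauchy q _ ε>0 =
    0 , λ _ _ _ _ → subst (ℚ._< _) (sym (cong ℚ.∣_∣ (ℚ.+-inverseʳ q))) ε>0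

  neg-cauchy : ∀ a → IsCauchy a → IsCauchy (λ n → ℚ.- a n)
  neg-cauchy a ca ε ε>0 with ca ε ε>0
  ... | N , h = N , λ m n N≤m N≤n →
    subst (ℚ._< _) (trans (∣p-q∣≡∣q-p∣ (a m) (a n)) (cong ℚ.∣_∣
      (solve 2 (λ p q → q :- p := (:- p) :- (:- q)) refl (a m) (a n))))
      (h m n N≤m N≤n)
    where open +-*-Solver

  abs-cauchy : ∀ a → IsCauchy a → IsCauchy (λ n → ℚ.∣ a n ∣)
  abs-cauchy a ca ε ε>0 with ca ε ε>0
  ... | N , h = N , λ m n N≤m N≤n →
    ℚ.≤-<-trans (∣∣p∣-∣q∣∣≤∣p-q∣ (a m) (a n)) (h m n N≤m N≤n)

  +-cauchy : ∀ a b → IsCauchy a → IsCauchy b → IsCauchy (λ n → a n ℚ.+ b n)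
  +-cauchy a b ca cb ε ε>0 with ca (½ ℚ.* ε) (half-pos ε>0) | cb (½ ℚ.* ε) (half-pos ε>0)
  ... | M , h | N , k = M ℕ.⊔ N , λ m n p q → begin-strict
      ℚ.∣ (a m ℚ.+ b m) ℚ.- (a n ℚ.+ b n) ∣
        ≡⟨ cong ℚ.∣_∣ (solve 4 (λ p q r s → (p :+ q) :- (r :+ s) := (p :- r) :+ (q :- s))
             refl (a m) (b m) (a n) (b n)) ⟩
      ℚ.∣ (a m ℚ.- a n) ℚ.+ (b m ℚ.- b n) ∣
        ≤⟨ ℚ.∣p+q∣≤∣p∣+∣q∣ (a m ℚ.- a n) (b m ℚ.- b n) ⟩
      ℚ.∣ a m ℚ.- a n ∣ ℚ.+ ℚ.∣ b m ℚ.- b n ∣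
        <⟨ ℚ.+-mono-< (h m n (ℕ.m⊔n≤o⇒m≤o M N p) (ℕ.m⊔n≤o⇒m≤o M N q))
                      (k m n (ℕ.m⊔n≤o⇒n≤o M N p) (ℕ.m⊔n≤o⇒n≤o M N q)) ⟩
      ½ ℚ.* ε ℚ.+ ½ ℚ.* ε
        ≡⟨ half+half ε ⟩
      ε ∎
    where open +-*-Solver
          open ℚ.≤-Reasoning

  eventually-bounded : ∀ a → IsCauchy a →
    ∃[ B ] (0ℚ ℚ.< B × ∃[ N ] (∀ n → N ≤ n → ℚ.∣ a n ∣ ℚ.≤ B))
  eventually-bounded a ca with ca 1ℚ (ℚ.positive⁻¹ 1ℚ)
  ... | N , h = 1ℚ ℚ.+ ℚ.∣ a N ∣
              , ℚ.+-mono-<-≤ (ℚ.positive⁻¹ 1ℚ) (ℚ.0≤∣p∣ (a N))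
              , N
              , λ n N≤n → ℚ.≤-trans (∣p∣≤∣p-q∣+∣q∣ (a n) (a N))
                  (ℚ.+-monoˡ-≤ ℚ.∣ a N ∣ (ℚ.<⇒≤ (h n N N≤n ℕ.≤-refl)))

  quotient-pos : ∀ {B ε} → 0ℚ ℚ.< B → 0ℚ ℚ.< ε → ∃[ η ] (0ℚ ℚ.< η × B ℚ.* η ≡ ε)
  quotient-pos {B} {ε} B>0 ε>0 = B⁻¹ ℚ.* ε , η>0 , B*η≡ε
    where
    instance
      _ = ℚ.positive B>0
      _ = ℚ.pos⇒nonZero B
    B⁻¹ = ℚ.1/ B
    instance
      _ = ℚ.1/pos⇒pos B
    η>0 : 0ℚ ℚ.< B⁻¹ ℚ.* ε
    η>0 = subst (ℚ._< B⁻¹ ℚ.* ε) (ℚ.*-zeroʳ B⁻¹) (ℚ.*-monoʳ-<-pos B⁻¹ ε>0)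
    B*η≡ε : B ℚ.* (B⁻¹ ℚ.* ε) ≡ ε
    B*η≡ε = trans (sym (ℚ.*-assoc B B⁻¹ ε))
      (trans (cong (ℚ._* ε) (ℚ.*-inverseʳ B)) (ℚ.*-identityˡ ε))

  *-difference : ∀ p q r s → p ℚ.* q ℚ.- r ℚ.* s ≡ p ℚ.* (q ℚ.- s) ℚ.+ s ℚ.* (p ℚ.- r)
  *-difference = solve 4 (λ p q r s →
      p :* q :- r :* s := p :* (q :- s) :+ s :* (p :- r)) refl
    where open +-*-Solver

  *-bound : ∀ {p q B η} → 0ℚ ℚ.< B → ℚ.∣ p ∣ ℚ.≤ B → ℚ.∣ q ∣ ℚ.< η →
    ℚ.∣ p ℚ.* q ∣ ℚ.< B ℚ.* η
  *-bound {p} {q} {B} {η} B>0 p≤B q<η = begin-strict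
    ℚ.∣ p ℚ.* q ∣          ≡⟨ ℚ.∣p*q∣≡∣p∣*∣q∣ p q ⟩
    ℚ.∣ p ∣ ℚ.* ℚ.∣ q ∣    ≤⟨ ℚ.*-monoʳ-≤-nonNeg ℚ.∣ q ∣ {{ℚ.∣-∣-nonNeg q}} p≤B ⟩
    B ℚ.* ℚ.∣ q ∣          <⟨ ℚ.*-monoʳ-<-pos B {{ℚ.positive B>0}} q<η ⟩
    B ℚ.* η                ∎
    where open ℚ.≤-Reasoning

  *-difference-bound : ∀ {p q r s A B η θ} → 0ℚ ℚ.< A → 0ℚ ℚ.< B →
    ℚ.∣ p ∣ ℚ.≤ A → ℚ.∣ s ∣ ℚ.≤ B → ℚ.∣ q ℚ.- s ∣ ℚ.< η → ℚ.∣ p ℚ.- r ∣ ℚ.< θ →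
    ℚ.∣ p ℚ.* q ℚ.- r ℚ.* s ∣ ℚ.< A ℚ.* η ℚ.+ B ℚ.* θ
  *-difference-bound {p} {q} {r} {s} {A} {B} {η} {θ} A>0 B>0 p≤A s≤B q-s<η p-r<θ =
    begin-strict
      ℚ.∣ p ℚ.* q ℚ.- r ℚ.* s ∣
        ≡⟨ cong ℚ.∣_∣ (*-difference p q r s) ⟩
      ℚ.∣ p ℚ.* (q ℚ.- s) ℚ.+ s ℚ.* (p ℚ.- r) ∣
        ≤⟨ ℚ.∣p+q∣≤∣p∣+∣q∣ (p ℚ.* (q ℚ.- s)) (s ℚ.* (p ℚ.- r)) ⟩
      ℚ.∣ p ℚ.* (q ℚ.- s) ∣ ℚ.+ ℚ.∣ s ℚ.* (p ℚ.- r) ∣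
        <⟨ ℚ.+-mono-< (*-bound {p} {q ℚ.- s} A>0 p≤A q-s<η)
                      (*-bound {s} {p ℚ.- r} B>0 s≤B p-r<θ) ⟩
      A ℚ.* η ℚ.+ B ℚ.* θ ∎
    where open ℚ.≤-Reasoning

  *-cauchy : ∀ a b → IsCauchy a → IsCauchy b → IsCauchy (λ n → a n ℚ.* b n)
  *-cauchy a b ca cb ε ε>0 =
    let A , A>0 , K , a≤A = eventually-bounded a ca
        B , B>0 , L , b≤B = eventually-bounded b cb
        η , η>0 , Aη≡ = quotient-pos A>0 (half-pos ε>0)
        θ , θ>0 , Bθ≡ = quotient-pos B>0 (half-pos ε>0)
        M , b<η = cb η η>0
        N , a<θ = ca θ θ>0
    in (K ℕ.⊔ L) ℕ.⊔ (M ℕ.⊔ N) , λ m n ≤m ≤n →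
    let KL≤m = ℕ.m⊔n≤o⇒m≤o (K ℕ.⊔ L) (M ℕ.⊔ N) ≤m
        KL≤n = ℕ.m⊔n≤o⇒m≤o (K ℕ.⊔ L) (M ℕ.⊔ N) ≤n
        MN≤m = ℕ.m⊔n≤o⇒n≤o (K ℕ.⊔ L) (M ℕ.⊔ N) ≤m
        MN≤n = ℕ.m⊔n≤o⇒n≤o (K ℕ.⊔ L) (M ℕ.⊔ N) ≤n
    in subst (ℚ.∣ a m ℚ.* b m ℚ.- a n ℚ.* b n ∣ ℚ.<_)
         (trans (cong₂ ℚ._+_ Aη≡ Bθ≡) (half+half ε))
         (*-difference-bound {a m} {b m} {a n} {b n} A>0 B>0
           (a≤A m (ℕ.m⊔n≤o⇒m≤o K L KL≤m))
           (b≤B n (ℕ.m⊔n≤o⇒n≤o K L KL≤n))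
           (b<η m n (ℕ.m⊔n≤o⇒m≤o M N MN≤m) (ℕ.m⊔n≤o⇒m≤o M N MN≤n))
           (a<θ m n (ℕ.m⊔n≤o⇒n≤o M N MN≤m) (ℕ.m⊔n≤o⇒n≤o M N MN≤n)))

infix  4 _≃ℝ_ _<ℝ_ _≤ℝ_
infixl 6 _+ℝ_ _-ℝ_
infixl 7 _*ℝ_
infixr 8 _^ℝ_

fromℚ : ℚ → ℝ
fromℚ q = mkℝ (λ _ → q) (const-cauchy q)

fromℕ : ℕ → ℝ
fromℕ n = fromℚ (+ n ℚ./ 1)

0ℝ 1ℝ : ℝ
0ℝ = fromℚ 0ℚ
1ℝ = fromℚ 1ℚ

_+ℝ_ _-ℝ_ _*ℝ_ : ℝ → ℝ → ℝ
x +ℝ y = mkℝ (λ n → seq x n ℚ.+ seq y n) (+-cauchy (seq x) (seq y) (cauchy x) (cauchy y))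
x -ℝ y = mkℝ (λ n → seq x n ℚ.- seq y n)
  (+-cauchy (seq x) (λ n → ℚ.- seq y n) (cauchy x) (neg-cauchy (seq y) (cauchy y)))
x *ℝ y = mkℝ (λ n → seq x n ℚ.* seq y n) (*-cauchy (seq x) (seq y) (cauchy x) (cauchy y))

∣_∣ℝ : ℝ → ℝ
∣ x ∣ℝ = mkℝ (λ n → ℚ.∣ seq x n ∣) (abs-cauchy (seq x) (cauchy x))

_^ℝ_ : ℝ → ℕ → ℝ
x ^ℝ zero  = 1ℝ
x ^ℝ suc n = x *ℝ x ^ℝ n

_<ℝ_ _≤ℝ_ _≃ℝ_ : ℝ → ℝ → Set
x <ℝ y = ∃[ q ] (0ℚ ℚ.< q × ∃[ N ] (∀ n → N ≤ n → seq x n ℚ.+ q ℚ.≤ seq y n))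
x ≤ℝ y = ∀ q → 0ℚ ℚ.< q → ∃[ N ] (∀ n → N ≤ n → seq x n ℚ.≤ seq y n ℚ.+ q)
x ≃ℝ y = ∀ q → 0ℚ ℚ.< q → ∃[ N ] (∀ n → N ≤ n → ℚ.∣ seq x n ℚ.- seq y n ∣ ℚ.≤ q)

_ConvergesTo_ : (ℕ → ℝ) → ℝ → Set
a ConvergesTo L = ∀ ε → 0ℝ <ℝ ε → ∃[ N ] (∀ n → N ≤ n → ∣ a n -ℝ L ∣ℝ <ℝ ε)

Convergent : (ℕ → ℝ) → Set
Convergent a = ∃[ L ] (a ConvergesTo L)

Subexponential : (ℕ → ℕ) → Set
Subexponential f = ∀ δ → 0ℝ <ℝ δ →
  ∃[ C ] (0ℝ <ℝ C × (∀ n → 1 ≤ n → fromℕ (f n) ≤ℝ C *ℝ (1ℝ +ℝ δ) ^ℝ n))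

count : ∀ {n} {P : Pred (Fin n) 0ℓ} → Decidable P → ℕ
count {n} P? = length (filter P? (allFin n))

-- The value on the empty set, where the proportion is undefined, is 0.
proportion : ∀ {n} {P : Pred (Fin n) 0ℓ} → Decidable P → ℚ
proportion {zero}  P? = 0ℚ
proportion {suc n} P? = + count P? ℚ./ suc n

record Graph : Set where
  field
    order     : ℕ
    adjacent  : Fin order → Fin order → Bool
    symmetric : ∀ x y → adjacent x y ≡ adjacent y x
    loopless  : ∀ x → adjacent x x ≡ false

  Vertex : Set
  Vertex = Fin order

  Adj : Vertex → Vertex → Set
  Adj x y = T (adjacent x y)

  degree : Vertex → ℕ
  degree x = count (λ y → T? (adjacent x y))

open Graph public

MaxDegree≤ : ℕ → Graph → Set
MaxDegree≤ d G = ∀ x → degree G x ≤ d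

-- Dist≤ G r x y: there is a walk of at most r edges from x to y.
data Dist≤ (G : Graph) : ℕ → Vertex G → Vertex G → Set where
  here : ∀ {r x} → Dist≤ G r x x
  step : ∀ {r x y z} → Adj G x y → Dist≤ G r y z → Dist≤ G (suc r) x z

dist≤? : ∀ G r x y → Dec (Dist≤ G r x y)
dist≤? G zero    x y = map′ (λ { refl → here }) (λ { here → refl }) (x Fin.≟ y)
dist≤? G (suc r) x y = map′
  (λ { (inj₁ refl) → here ; (inj₂ (_ , e , w)) → step e w })
  (λ { here → inj₁ refl ; (step e w) → inj₂ (_ , e , w) })
  (x Fin.≟ y ⊎-dec any? (λ z → T? (adjacent G x z) ×-dec dist≤? G r z y))

Connected : Graph → Set
Connected G = ∀ x y → ∃[ r ] Dist≤ G r x y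

-- Used only for lists without repetitions; the i-th vertex of the induced
-- graph is the i-th entry of the list.
induced : (G : Graph) → List (Vertex G) → Graph
induced G vs = record
  { order     = length vs
  ; adjacent  = λ i j → adjacent G (lookup vs i) (lookup vs j)
  ; symmetric = λ i j → symmetric G (lookup vs i) (lookup vs j)
  ; loopless  = λ i → loopless G (lookup vs i)
  }

record RootedGraph : Set where
  constructor _rootedAt_
  field
    graph : Graph
    root  : Vertex graph

open RootedGraph public

ballVertices : (G : Graph) → ℕ → Vertex G → List (Vertex G)
ballVertices G r x = filter (dist≤? G r x) (allFin (order G))

centre∈ball : ∀ G r x → x ∈ ballVertices G r x
centre∈ball G r x = ∈-filter⁺ (dist≤? G r x) (∈-allFin x) here

ball : (G : Graph) → ℕ → Vertex G → RootedGraph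
ball G r x = induced G (ballVertices G r x) rootedAt index (centre∈ball G r x)

record _≅_ (G H : Graph) : Set where
  field
    bijection : Vertex G ↔ Vertex H

  open Inverse bijection public using (to; from)

  field
    preserves : ∀ x y → adjacent G x y ≡ adjacent H (to x) (to y)

record _≅ᵣ_ (A B : RootedGraph) : Set where
  field
    iso : graph A ≅ graph B

  open _≅_ iso public

  field
    preserves-root : to (root A) ≡ root B

private

  module _ (A B : RootedGraph) where

    VA = Vertex (graph A)
    VB = Vertex (graph B)

    RootedIsoPair : (VA → VB) → (VB → VA) → Set
    RootedIsoPair f g =
      (∀ y → f (g y) ≡ y) × (∀ x → g (f x) ≡ x) ×
      (∀ x y → adjacent (graph A) x y ≡ adjacent (graph B) (f x) (f y)) ×
      f (root A) ≡ root B

    rootedIsoPair? : ∀ f g → Dec (RootedIsoPair f g)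
    rootedIsoPair? f g =
      all? (λ y → f (g y) Fin.≟ y) ×-dec
      all? (λ x → g (f x) Fin.≟ x) ×-dec
      all? (λ x → all? λ y →
        adjacent (graph A) x y Bool.≟ adjacent (graph B) (f x) (f y)) ×-dec
      f (root A) Fin.≟ root B

    RootedIsoPair-resp : ∀ {f f′ g g′} → (∀ x → f′ x ≡ f x) → (∀ y → g′ y ≡ g y) →
      RootedIsoPair f g → RootedIsoPair f′ g′
    RootedIsoPair-resp {f} {f′} {g} {g′} f≗ g≗ (fg , gf , pres , rt) =
      (λ y → trans (trans (f≗ (g′ y)) (cong f (g≗ y))) (fg y)) ,
      (λ x → trans (trans (g≗ (f′ x)) (cong g (f≗ x))) (gf x)) ,
      (λ x y → trans (pres x y)
        (sym (cong₂ (adjacent (graph B)) (f≗ x) (f≗ y)))) ,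
      trans (f≗ (root A)) rt

    pair⇒≅ᵣ : ∀ {f g} → RootedIsoPair f g → A ≅ᵣ B
    pair⇒≅ᵣ {f} {g} (fg , gf , pres , rt) = record
      { iso = record { bijection = mk↔ₛ′ f g fg gf ; preserves = pres }
      ; preserves-root = rt
      }

    ≅ᵣ⇒pair : (φ : A ≅ᵣ B) → RootedIsoPair (_≅ᵣ_.to φ) (_≅ᵣ_.from φ)
    ≅ᵣ⇒pair φ =
      Inverse.strictlyInverseˡ φ.bijection ,
      Inverse.strictlyInverseʳ φ.bijection ,
      φ.preserves , φ.preserves-root
      where module φ = _≅ᵣ_ φ

_≅ᵣ?_ : ∀ A B → Dec (A ≅ᵣ B)
A ≅ᵣ? B = map′
  (λ { (_ , _ , h) → pair⇒≅ᵣ A B h })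
  (λ φ → _ , _ , RootedIsoPair-resp A B
    (finToFun-funToFin (_≅ᵣ_.to φ)) (finToFun-funToFin (_≅ᵣ_.from φ)) (≅ᵣ⇒pair A B φ))
  (any? λ i → any? λ j → rootedIsoPair? A B (finToFun i) (finToFun j))

-- The elements of U r d are representatives; two of them are the same rooted
-- isomorphism class when their underlying rooted graphs are related by _≅ᵣ_.
record U (r d : ℕ) : Set where
  field
    rootedGraph : RootedGraph
    maxDegree   : MaxDegree≤ d (graph rootedGraph)
    connected   : Connected (graph rootedGraph)
    radius      : ∀ y → Dist≤ (graph rootedGraph) r (root rootedGraph) y

open U public using (rootedGraph)

frequency : ∀ {r d} → Graph → U r d → ℚ
frequency {r} G α = proportion (λ x → ball G r x ≅ᵣ? rootedGraph α)

record WeaklyConvergent (d : ℕ) (G : ℕ → Graph) : Set where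
  field
    unbounded  : ∀ M → ∃[ n₀ ] (∀ n → n₀ ≤ n → M ≤ order (G n))
    statistics : ∀ r → 1 ≤ r → (α : U r d) → Convergent (λ n → fromℚ (frequency (G n) α))

record Graphᵈᶠ (d : ℕ) (f : ℕ → ℕ) : Set where
  field
    underlying : Graph
    maxDegree  : MaxDegree≤ d underlying
    growth     : ∀ x r → 1 ≤ r → order (graph (ball underlying r x)) ≤ f r

open Graphᵈᶠ public using (underlying)

record Parameter (d : ℕ) (f : ℕ → ℕ) : Set where
  field
    value     : Graphᵈᶠ d f → ℝ
    invariant : ∀ G H → underlying G ≅ underlying H → value G ≃ℝ value H

open Parameter public using (value)

Continuous : ∀ {d f} → Parameter d f → Set
Continuous {d} {f} ζ = (G : ℕ → Graphᵈᶠ d f) →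
  WeaklyConvergent d (underlying ∘ G) → Convergent (λ n → value ζ (G n))

-- The union over s ≤ r of the sets U s d is a disjoint one: the radius s of a
-- pattern is part of the data.
Pattern : ℕ → ℕ → Set
Pattern r d = Σ[ s ∈ ℕ ] (1 ≤ s × s ≤ r × U s d)

Distribution : ℕ → ℕ → Set
Distribution r d = Pattern r d → ℚ

empirical : ∀ {k} r d (G : Graph) → (Fin k → Vertex G) → Distribution r d
empirical r d G x (s , _ , _ , α) = proportion (λ i → ball G s (x i) ≅ᵣ? rootedGraph α)

-- For fixed r, d and k there are only finitely many empirical distributions, so
-- an algorithm on them is a finite table, that is, a function. Respect for
-- pointwise equality is a field because function extensionality is unavailable.
record Tester (r d : ℕ) : Set where
  field
    calculate   : Distribution r d → ℝ
    extensional : ∀ Y Y′ → (∀ α → Y α ≡ Y′ α) → calculate Y ≃ℝ calculate Y′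

open Tester public using (calculate)

-- Probability of an event for k independent uniform elements of Fin n;
-- finToFun enumerates all n ^ k functions Fin k → Fin n.
Prob : ∀ {n k} {E : Pred (Fin k → Fin n) 0ℓ} → Decidable E → ℚ
Prob {n} {k} E? = proportion {n ℕ.^ k} (λ ω → E? (finToFun {n} {k} ω))

-- Prob needs a decidable event, and the order of the reals is decidable only
-- by excluded middle.
Testable : ExcludedMiddle 0ℓ → ∀ {d f} → Parameter d f → Set
Testable em {d} {f} ζ = ∀ ε → 0ℝ <ℝ ε →
  ∃[ N ] ∃[ r ] ∃[ k ] (1 ≤ N × 1 ≤ r × 1 ≤ k ×
    Σ[ t ∈ Tester r d ] ((G : Graphᵈᶠ d f) → N ≤ order (underlying G) →
      fromℚ (Prob {order (underlying G)} {k}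
        (λ x → em {ε <ℝ ∣ calculate t (empirical r d (underlying G) x) -ℝ value ζ G ∣ℝ}))
      <ℝ ε))

{-# OPTIONS --safe #-}

-- Rooted graphs have natural-number codes that determine them up to
-- isomorphism, so a diagonal argument gives every sequence of graphs a
-- subsequence along which all neighbourhood frequencies converge.  Hence a
-- continuous ζ is uniformly continuous: for each ε there is an n such that
-- ζ G and ζ H differ by at most ε whenever G and H have at least n vertices and
-- nearly the same frequencies of the patterns with key at most n.  Otherwise
-- counterexample pairs (G, H) would interleave into a weakly convergent sequence
-- along which ζ diverges.  The tester outputs ζ H for any large H whose
-- frequencies fit the sample; by Chebyshev's inequality G itself fits with high
-- probability, and then ζ H is close to ζ G.
module Submission where

open import Algebra.Bundles using (CommutativeRing)
open import Axiom.ExcludedMiddle using (ExcludedMiddle)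
open import Data.Bool.Base using (Bool; if_then_else_)
open import Data.Fin.Base using (Fin; zero; suc; toℕ; finToFun; funToFin; combine; _↑ˡ_; _↑ʳ_)
open import Data.Fin.Properties using (2↔Bool; toℕ-injective; finToFun-funToFin; remQuot-combine)
open import Data.Integer.Base as ℤ using (+_; +≤+)
import Data.Integer.Properties as ℤ
open import Data.List.Base as List using (List; []; _∷_; length; filter; allFin)
open import Data.List.Properties using (filter-≐)
open import Data.List.Relation.Unary.Any as Any using (Any; here; there)
open import Data.List.Relation.Unary.Any.Properties using (lookup-index)
open import Data.Nat.Base as ℕ using (ℕ; zero; suc; _≤_; _<_; z≤n; s≤s; ⌊_/2⌋)
import Data.Nat.Properties as ℕ
open import Data.Product.Base using (Σ-syntax; ∃-syntax; _×_; _,_; proj₁; proj₂)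
open import Data.Rational.Base as ℚ using (ℚ; mkℚ; 0ℚ; 1ℚ; ½; toℚᵘ)
import Data.Rational.Properties as ℚ
open import Data.Rational.Solver using (module +-*-Solver)
open import Data.Rational.Unnormalised.Base as ℚᵘ using (mkℚᵘ)
import Data.Rational.Unnormalised.Properties as ℚᵘ
open import Data.Sum.Base as Sum using (_⊎_; inj₁; inj₂; [_,_]′)
open import Data.Vec.Base as Vec using (Vec)
open import Data.Vec.Properties using (tabulate-cong; lookup∘tabulate)
open import Function.Base using (_∘_; id)
open import Function.Bundles using (mk↔ₛ′; module Inverse)
open import Function.Construct.Composition using (_↔-∘_)
open import Level using (0ℓ)
open import Relation.Binary.PropositionalEquality
  using (_≡_; refl; sym; trans; cong; cong₂; subst; subst₂; module ≡-Reasoning)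
open import Relation.Nullary.Decidable using (Dec; yes; no; does; decidable-stable)
open import Relation.Nullary.Negation using (¬_; contradiction)
open import Relation.Unary using (Pred; Decidable; _⊆_; _∩_; ∁)
open import Defs

open import Algebra.Properties.Semiring.Sum
  (CommutativeRing.semiring ℚ.+-*-commutativeRing)
  using (sum; sum-cong-≗; ∑-distrib-+; ∑-comm; *-distribˡ-sum; *-distribʳ-sum)
open +-*-Solver using (solve; _:=_; _:+_; _:*_; _:-_; :-_; con)

-- Naturals and unit fractions as rationals; ordered-field inequalities.

toℚᵘ-/ : ∀ i n → toℚᵘ (i ℚ./ suc n) ℚᵘ.≃ mkℚᵘ i n
toℚᵘ-/ i n = ℚ.toℚᵘ-fromℚᵘ (mkℚᵘ i n)

-- Left transparent, ι and τ would unfold to gcd computations during unification.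
opaque

  ι : ℕ → ℚ
  ι n = + n ℚ./ 1

  τ : ℕ → ℚ
  τ n = + 1 ℚ./ suc n

  ι-+ : ∀ m n → ι (m ℕ.+ n) ≡ ι m ℚ.+ ι n
  ι-+ m n = ℚ.toℚᵘ-injective (begin
    toℚᵘ (ι (m ℕ.+ n))            ≈⟨ toℚᵘ-/ (+ (m ℕ.+ n)) 0 ⟩
    mkℚᵘ (+ (m ℕ.+ n)) 0          ≈⟨ ℚᵘ.*≡* (cong (ℤ._* + 1) (cong₂ ℤ._+_ (sym (ℤ.*-identityʳ (+ m))) (sym (ℤ.*-identityʳ (+ n))))) ⟩
    mkℚᵘ (+ m) 0 ℚᵘ.+ mkℚᵘ (+ n) 0 ≈⟨ ℚᵘ.+-cong (toℚᵘ-/ (+ m) 0) (toℚᵘ-/ (+ n) 0) ⟨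
    toℚᵘ (ι m) ℚᵘ.+ toℚᵘ (ι n)    ≈⟨ ℚ.toℚᵘ-homo-+ (ι m) (ι n) ⟨
    toℚᵘ (ι m ℚ.+ ι n)            ∎)
    where open ℚᵘ.≃-Reasoning

  ι0≡0 : ι 0 ≡ 0ℚ
  ι0≡0 = refl

  ι-suc : ∀ n → ι (suc n) ≡ 1ℚ ℚ.+ ι n
  ι-suc = ι-+ 1

  /≡ι*τ : ∀ m n → + m ℚ./ suc n ≡ ι m ℚ.* τ n
  /≡ι*τ m n = ℚ.toℚᵘ-injective (begin
    toℚᵘ (+ m ℚ./ suc n)            ≈⟨ toℚᵘ-/ (+ m) n ⟩
    mkℚᵘ (+ m) n                    ≈⟨ ℚᵘ.*≡* (cong₂ ℤ._*_ (sym (ℤ.*-identityʳ (+ m))) (cong +_ (ℕ.+-identityʳ (suc n)))) ⟩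
    mkℚᵘ (+ m) 0 ℚᵘ.* mkℚᵘ (+ 1) n  ≈⟨ ℚᵘ.*-cong (toℚᵘ-/ (+ m) 0) (toℚᵘ-/ (+ 1) n) ⟨
    toℚᵘ (ι m) ℚᵘ.* toℚᵘ (τ n)      ≈⟨ ℚ.toℚᵘ-homo-* (ι m) (τ n) ⟨
    toℚᵘ (ι m ℚ.* τ n)              ∎)
    where open ℚᵘ.≃-Reasoning

  ι*τ≡1 : ∀ n → ι (suc n) ℚ.* τ n ≡ 1ℚ
  ι*τ≡1 n = trans (sym (/≡ι*τ (suc n) n))
    (ℚ.toℚᵘ-injective (ℚᵘ.≃-trans (toℚᵘ-/ (+ suc n) n) (ℚᵘ.*≡* (ℤ.*-comm (+ suc n) (+ 1)))))

  0≤ι : ∀ n → 0ℚ ℚ.≤ ι n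
  0≤ι n = ℚ.nonNegative⁻¹ (ι n) {{ℚ.normalize-nonNeg n 1}}

  0<ι : ∀ n → 0ℚ ℚ.< ι (suc n)
  0<ι n = ℚ.positive⁻¹ (ι (suc n)) {{ℚ.normalize-pos (suc n) 1}}

  0<τ : ∀ n → 0ℚ ℚ.< τ n
  0<τ n = ℚ.positive⁻¹ (τ n) {{ℚ.normalize-pos 1 (suc n)}}

  τ-vanishes : ∀ {ε} → 0ℚ ℚ.< ε → ∃[ M ] (∀ n → M ≤ n → τ n ℚ.≤ ε)
  τ-vanishes {mkℚ (+ zero) d c}    (ℚ.*<* 0<0) = contradiction 0<0 (λ { (ℤ.+<+ ()) })
  τ-vanishes {mkℚ (ℤ.-[1+ _ ]) d c} (ℚ.*<* ())
  -- The field `d` stores the denominator minus one, so the given rational is at least `τ d`.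
  τ-vanishes {mkℚ (+ suc a) d c}   _ = d , λ n d≤n →
    ℚ.toℚᵘ-cancel-≤ (ℚᵘ.≤-respˡ-≃ (ℚᵘ.≃-sym (toℚᵘ-/ (+ 1) n))
      (ℚᵘ.*≤* (+≤+ (ℕ.*-mono-≤ {1} {suc a} (s≤s z≤n) (s≤s d≤n)))))

ι0*p≡0 : ∀ p → ι 0 ℚ.* p ≡ 0ℚ
ι0*p≡0 p = trans (cong (ℚ._* p) ι0≡0) (ℚ.*-zeroˡ p)

ι-* : ∀ m n → ι (m ℕ.* n) ≡ ι m ℚ.* ι n
ι-* zero    n = trans ι0≡0 (sym (ι0*p≡0 (ι n)))
ι-* (suc m) n = begin
  ι (n ℕ.+ m ℕ.* n)             ≡⟨ ι-+ n (m ℕ.* n) ⟩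
  ι n ℚ.+ ι (m ℕ.* n)           ≡⟨ cong (ι n ℚ.+_) (ι-* m n) ⟩
  ι n ℚ.+ ι m ℚ.* ι n           ≡⟨ solve 2 (λ a b → b :+ a :* b := (con 1ℚ :+ a) :* b) refl (ι m) (ι n) ⟩
  (1ℚ ℚ.+ ι m) ℚ.* ι n          ≡⟨ cong (ℚ._* ι n) (ι-suc m) ⟨
  ι (suc m) ℚ.* ι n             ∎
  where open ≡-Reasoning

archimedean : ∀ {ε} → 0ℚ ℚ.< ε → ∃[ M ] 1ℚ ℚ.≤ ι (suc M) ℚ.* ε
archimedean {ε} ε>0 with τ-vanishes ε>0
... | M , small = M , subst (ℚ._≤ ι (suc M) ℚ.* ε) (ι*τ≡1 M)
  (ℚ.*-monoˡ-≤-nonNeg (ι (suc M)) {{ℚ.nonNegative (0≤ι (suc M))}} (small M ℕ.≤-refl))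

*-nonneg : ∀ {p q} → 0ℚ ℚ.≤ p → 0ℚ ℚ.≤ q → 0ℚ ℚ.≤ p ℚ.* q
*-nonneg {p} {q} 0≤p 0≤q = subst (ℚ._≤ p ℚ.* q) (ℚ.*-zeroʳ p)
  (ℚ.*-monoˡ-≤-nonNeg p {{ℚ.nonNegative 0≤p}} 0≤q)

*-pos : ∀ {p q} → 0ℚ ℚ.< p → 0ℚ ℚ.< q → 0ℚ ℚ.< p ℚ.* q
*-pos {p} {q} 0<p 0<q = subst (ℚ._< p ℚ.* q) (ℚ.*-zeroʳ p)
  (ℚ.*-monoʳ-<-pos p {{ℚ.positive 0<p}} 0<q)

*-mono-≤ : ∀ {p q r s} → 0ℚ ℚ.≤ p → 0ℚ ℚ.≤ s → p ℚ.≤ q → r ℚ.≤ s → p ℚ.* r ℚ.≤ q ℚ.* s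
*-mono-≤ {p} {q} {r} {s} 0≤p 0≤s p≤q r≤s = ℚ.≤-trans
  (ℚ.*-monoˡ-≤-nonNeg p {{ℚ.nonNegative 0≤p}} r≤s)
  (ℚ.*-monoʳ-≤-nonNeg s {{ℚ.nonNegative 0≤s}} p≤q)

*-cancelʳ-≤ : ∀ {p q r} → 0ℚ ℚ.< r → p ℚ.* r ℚ.≤ q ℚ.* r → p ℚ.≤ q
*-cancelʳ-≤ {r = r} 0<r = ℚ.*-cancelʳ-≤-pos r {{ℚ.positive 0<r}}

square : ℚ → ℚ
square p = p ℚ.* p

square-∣∣ : ∀ p → square p ≡ square ℚ.∣ p ∣
square-∣∣ p with ℚ.∣p∣≡p∨∣p∣≡-p p
... | inj₁ eq = sym (cong square eq)
... | inj₂ eq = trans (solve 1 (λ p → p :* p := (:- p) :* (:- p)) refl p) (sym (cong square eq))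

0≤square : ∀ p → 0ℚ ℚ.≤ square p
0≤square p = subst (0ℚ ℚ.≤_) (sym (square-∣∣ p)) (*-nonneg (ℚ.0≤∣p∣ p) (ℚ.0≤∣p∣ p))

-- Finite sums of rationals.

sum-mono : ∀ {n} {f g : Fin n → ℚ} → (∀ i → f i ℚ.≤ g i) → sum f ℚ.≤ sum g
sum-mono {zero}  f≤g = ℚ.≤-refl
sum-mono {suc n} f≤g = ℚ.+-mono-≤ (f≤g zero) (sum-mono (f≤g ∘ suc))

sum-const : ∀ n c → sum {n} (λ _ → c) ≡ ι n ℚ.* c
sum-const zero    c = sym (ι0*p≡0 c)
sum-const (suc n) c = begin
  c ℚ.+ sum {n} (λ _ → c)   ≡⟨ cong (c ℚ.+_) (sum-const n c) ⟩
  c ℚ.+ ι n ℚ.* c           ≡⟨ solve 2 (λ a b → b :+ a :* b := (con 1ℚ :+ a) :* b) refl (ι n) c ⟩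
  (1ℚ ℚ.+ ι n) ℚ.* c        ≡⟨ cong (ℚ._* c) (ι-suc n) ⟨
  ι (suc n) ℚ.* c           ∎
  where open ≡-Reasoning

sum-nonneg : ∀ {n} {f : Fin n → ℚ} → (∀ i → 0ℚ ℚ.≤ f i) → 0ℚ ℚ.≤ sum f
sum-nonneg {n} {f} 0≤f = subst (ℚ._≤ sum f) (trans (sum-const n 0ℚ) (ℚ.*-zeroʳ (ι n))) (sum-mono 0≤f)

term≤sum : ∀ {n} {f : Fin n → ℚ} → (∀ i → 0ℚ ℚ.≤ f i) → ∀ i → f i ℚ.≤ sum f
term≤sum {suc n} {f} 0≤f zero = subst (ℚ._≤ sum f) (ℚ.+-identityʳ (f zero))
  (ℚ.+-monoʳ-≤ (f zero) (sum-nonneg (0≤f ∘ suc)))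
term≤sum {suc n} {f} 0≤f (suc i) = subst (ℚ._≤ sum f) (ℚ.+-identityˡ (f (suc i)))
  (ℚ.+-mono-≤ (0≤f zero) (term≤sum (0≤f ∘ suc) i))

sum-↑ : ∀ m {n} (f : Fin (m ℕ.+ n) → ℚ) →
  sum f ≡ sum (λ i → f (i ↑ˡ n)) ℚ.+ sum (λ j → f (m ↑ʳ j))
sum-↑ zero    f = sym (ℚ.+-identityˡ (sum f))
sum-↑ (suc m) f = trans (cong (f zero ℚ.+_) (sum-↑ m (f ∘ suc)))
  (sym (ℚ.+-assoc (f zero) _ _))

sum-combine : ∀ m n (f : Fin (m ℕ.* n) → ℚ) →
  sum f ≡ sum (λ i → sum (λ j → f (combine {m} {n} i j)))
sum-combine zero    n f = refl
sum-combine (suc m) n f = trans (sum-↑ n f)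
  (cong (sum (λ j → f (j ↑ˡ (m ℕ.* n))) ℚ.+_) (sum-combine m n (λ k → f (n ↑ʳ k))))

-- Proportions as sums of indicators.

indicator : {P : Set} → Dec P → ℚ
indicator P? = if does P? then 1ℚ else 0ℚ

0≤indicator : {P : Set} (P? : Dec P) → 0ℚ ℚ.≤ indicator P?
0≤indicator (yes _) = ℚ.nonNegative⁻¹ 1ℚ
0≤indicator (no _)  = ℚ.≤-refl

indicator≤1 : {P : Set} (P? : Dec P) → indicator P? ℚ.≤ 1ℚ
indicator≤1 (yes _) = ℚ.≤-refl
indicator≤1 (no _)  = ℚ.nonNegative⁻¹ 1ℚ

-- An arbitrary `f` is needed for the induction: peeling the first element off `allFin`, which is
-- `tabulate id`, leaves `tabulate suc`.
length-filter-tabulate : ∀ {A : Set} {P : Pred A 0ℓ} (P? : Decidable P) {n} (f : Fin n → A) →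
  ι (length (filter P? (List.tabulate f))) ≡ sum (λ i → indicator (P? (f i)))
length-filter-tabulate P? {zero}  f = ι0≡0
length-filter-tabulate P? {suc n} f with P? (f zero)
... | yes _ = trans (ι-suc (length (filter P? (List.tabulate (f ∘ suc))))) (cong (1ℚ ℚ.+_) (length-filter-tabulate P? (f ∘ suc)))
... | no _  = trans (length-filter-tabulate P? (f ∘ suc)) (sym (ℚ.+-identityˡ _))

-- The multiplied-out form avoids division and covers `n = 0`, where both sides vanish.
proportion-sum : ∀ {n} {P : Pred (Fin n) 0ℓ} (P? : Decidable P) →
  proportion P? ℚ.* ι n ≡ sum (λ x → indicator (P? x))
proportion-sum {zero}  P? = ℚ.*-zeroˡ (ι 0)
proportion-sum {suc n} P? = begin
  (+ count P? ℚ./ suc n) ℚ.* ι (suc n)     ≡⟨ cong (ℚ._* ι (suc n)) (/≡ι*τ (count P?) n) ⟩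
  (ι (count P?) ℚ.* τ n) ℚ.* ι (suc n)     ≡⟨ solve 3 (λ a b c → (a :* b) :* c := a :* (c :* b)) refl (ι (count P?)) (τ n) (ι (suc n)) ⟩
  ι (count P?) ℚ.* (ι (suc n) ℚ.* τ n)     ≡⟨ cong (ι (count P?) ℚ.*_) (ι*τ≡1 n) ⟩
  ι (count P?) ℚ.* 1ℚ                      ≡⟨ ℚ.*-identityʳ _ ⟩
  ι (count P?)                             ≡⟨ length-filter-tabulate P? id ⟩
  sum (λ x → indicator (P? x))             ∎
  where open ≡-Reasoning

0≤proportion : ∀ {n} {P : Pred (Fin n) 0ℓ} (P? : Decidable P) → 0ℚ ℚ.≤ proportion P?
0≤proportion {zero}  P? = ℚ.≤-refl
0≤proportion {suc n} P? = *-cancelʳ-≤ (0<ι n) (subst₂ ℚ._≤_ (sym (ℚ.*-zeroˡ (ι (suc n))))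
  (sym (proportion-sum P?)) (sum-nonneg (λ x → 0≤indicator (P? x))))

proportion≤1 : ∀ {n} {P : Pred (Fin n) 0ℓ} (P? : Decidable P) → proportion P? ℚ.≤ 1ℚ
proportion≤1 {zero}  P? = ℚ.nonNegative⁻¹ 1ℚ
proportion≤1 {suc n} P? = *-cancelʳ-≤ (0<ι n) (subst₂ ℚ._≤_ (sym (proportion-sum P?))
  (trans (sum-const (suc n) 1ℚ) (ℚ.*-comm (ι (suc n)) 1ℚ))
  (sum-mono (λ x → indicator≤1 (P? x))))

-- Second moments and concentration of sampled proportions.

module _ {n} (g : Fin n → ℚ) (Σg≡0 : sum g ≡ 0ℚ) (g²≤1 : ∀ x → square (g x) ℚ.≤ 1ℚ) where

  -- The cross terms cancel because g has mean zero.
  second-moment : ∀ k →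
    sum (λ ω → square (sum (λ i → g (finToFun {n} {k} ω i)))) ℚ.≤ ι k ℚ.* ι (n ℕ.^ k)
  second-moment zero    = *-nonneg (0≤ι 0) (0≤ι 1)
  second-moment (suc k) = begin
    sum (λ ω → square (sum (λ i → g (finToFun {n} {suc k} ω i))))
      ≡⟨ sum-combine n Z (λ ω → square (sum (λ i → g (finToFun {n} {suc k} ω i)))) ⟩
    sum (λ x → sum {Z} (λ ω → square (sum (λ i → g (finToFun {n} {suc k} (combine {n} {Z} x ω) i)))))
      ≡⟨ sum-cong-≗ (λ x → sum-cong-≗ (λ ω → cong square (split x ω))) ⟩
    sum (λ x → sum (λ ω → square (g x ℚ.+ S ω)))
      ≤⟨ sum-mono inner ⟩
    sum (λ x → A ℚ.+ g x ℚ.* B)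
      ≡⟨ ∑-distrib-+ (λ _ → A) (λ x → g x ℚ.* B) ⟩
    sum {n} (λ _ → A) ℚ.+ sum (λ x → g x ℚ.* B)
      ≡⟨ cong₂ ℚ._+_ (sum-const n A) (sym (*-distribʳ-sum B g)) ⟩
    ι n ℚ.* A ℚ.+ sum g ℚ.* B
      ≡⟨ cong (λ s → ι n ℚ.* A ℚ.+ s ℚ.* B) Σg≡0 ⟩
    ι n ℚ.* A ℚ.+ 0ℚ ℚ.* B
      ≡⟨ solve 4 (λ a k z b → a :* (z :+ k :* z) :+ con 0ℚ :* b := (con 1ℚ :+ k) :* (a :* z)) refl (ι n) (ι k) (ι Z) B ⟩
    (1ℚ ℚ.+ ι k) ℚ.* (ι n ℚ.* ι Z)
      ≡⟨ cong₂ ℚ._*_ (ι-suc k) (ι-* n Z) ⟨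
    ι (suc k) ℚ.* ι (n ℕ.* Z) ∎
    where
    open ℚ.≤-Reasoning
    Z = n ℕ.^ k
    S : Fin Z → ℚ
    S ω = sum (λ i → g (finToFun {n} {k} ω i))
    A B : ℚ
    A = ι Z ℚ.+ ι k ℚ.* ι Z
    B = (1ℚ ℚ.+ 1ℚ) ℚ.* sum S
    -- `finToFun` decodes `combine x ω` as the sample with first point `x` whose remaining points
    -- are coded by `ω`.
    split : ∀ x ω → sum (λ i → g (finToFun {n} {suc k} (combine {n} {Z} x ω) i)) ≡ g x ℚ.+ S ω
    split x ω = cong₂ ℚ._+_ (cong (g ∘ proj₁) eq)
      (sum-cong-≗ (λ i → cong (λ p → g (finToFun {n} {k} (proj₂ p) i)) eq))
      where eq = remQuot-combine {n} {Z} x ω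
    inner : ∀ x → sum (λ ω → square (g x ℚ.+ S ω)) ℚ.≤ A ℚ.+ g x ℚ.* B
    inner x = begin
      sum (λ ω → square (g x ℚ.+ S ω))
        ≡⟨ sum-cong-≗ (λ ω → solve 2 (λ a s → (a :+ s) :* (a :+ s) :=
             (a :* a :+ s :* s) :+ (a :* (con 1ℚ :+ con 1ℚ)) :* s) refl (g x) (S ω)) ⟩
      sum (λ ω → (square (g x) ℚ.+ square (S ω)) ℚ.+ c ℚ.* S ω)
        ≡⟨ ∑-distrib-+ (λ ω → square (g x) ℚ.+ square (S ω)) (λ ω → c ℚ.* S ω) ⟩
      sum (λ ω → square (g x) ℚ.+ square (S ω)) ℚ.+ sum (λ ω → c ℚ.* S ω)
        ≡⟨ cong₂ ℚ._+_ (∑-distrib-+ (λ _ → square (g x)) (square ∘ S)) (sym (*-distribˡ-sum c S)) ⟩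
      (sum {Z} (λ _ → square (g x)) ℚ.+ sum (square ∘ S)) ℚ.+ c ℚ.* sum S
        ≤⟨ ℚ.+-monoˡ-≤ (c ℚ.* sum S) (ℚ.+-mono-≤ (sum-mono {Z} (λ _ → g²≤1 x)) (second-moment k)) ⟩
      (sum {Z} (λ _ → 1ℚ) ℚ.+ ι k ℚ.* ι Z) ℚ.+ c ℚ.* sum S
        ≡⟨ cong₂ ℚ._+_ (cong (ℚ._+ ι k ℚ.* ι Z) (trans (sum-const Z 1ℚ) (ℚ.*-identityʳ (ι Z)))) (ℚ.*-assoc (g x) _ (sum S)) ⟩
      A ℚ.+ g x ℚ.* B ∎
      where c = g x ℚ.* (1ℚ ℚ.+ 1ℚ)

-- Markov's inequality with sums in place of expectations; it holds term by term.
markov : ∀ {n} {E : Pred (Fin n) 0ℓ} (E? : Decidable E) (F : Fin n → ℚ) t →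
  (∀ x → 0ℚ ℚ.≤ F x) → (∀ x → E x → t ℚ.≤ F x) →
  sum (λ x → indicator (E? x)) ℚ.* t ℚ.≤ sum F
markov E? F t 0≤F t≤F = subst (ℚ._≤ sum F) (sym (*-distribʳ-sum t (λ x → indicator (E? x)))) (sum-mono bound)
  where
  bound : ∀ x → indicator (E? x) ℚ.* t ℚ.≤ F x
  bound x with E? x
  ... | yes e = subst (ℚ._≤ F x) (sym (ℚ.*-identityˡ t)) (t≤F x e)
  ... | no _  = subst (ℚ._≤ F x) (sym (ℚ.*-zeroˡ t)) (0≤F x)

∣p-q∣≤1 : ∀ {p q} → 0ℚ ℚ.≤ p → p ℚ.≤ 1ℚ → 0ℚ ℚ.≤ q → q ℚ.≤ 1ℚ → ℚ.∣ p ℚ.- q ∣ ℚ.≤ 1ℚ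
∣p-q∣≤1 {p} {q} 0≤p p≤1 0≤q q≤1 with ℚ.∣p∣≡p∨∣p∣≡-p (p ℚ.- q)
... | inj₁ eq = subst₂ ℚ._≤_ (sym eq) (ℚ.+-identityʳ 1ℚ) (ℚ.+-mono-≤ p≤1 (ℚ.neg-antimono-≤ 0≤q))
... | inj₂ eq = subst₂ ℚ._≤_ (trans (solve 2 (λ p q → q :+ (:- p) := :- (p :- q)) refl p q) (sym eq))
  (ℚ.+-identityʳ 1ℚ) (ℚ.+-mono-≤ q≤1 (ℚ.neg-antimono-≤ 0≤p))

module _ {n k m : ℕ} {A : Fin m → Pred (Fin n) 0ℓ} (A? : ∀ j → Decidable (A j)) where

  deviation : Fin m → (Fin k → Fin n) → ℚ
  deviation j x = proportion (λ i → A? j (x i)) ℚ.- proportion (A? j)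

  private
    g : Fin m → Fin n → ℚ
    g j x = indicator (A? j x) ℚ.- proportion (A? j)

    S : Fin m → Fin (n ℕ.^ k) → ℚ
    S j ω = sum (λ i → g j (finToFun {n} {k} ω i))

    -- Used at two lengths: for a sample it turns the sum into a deviation, and for `x = id` the
    -- deviation is zero, which gives `Σg≡0`.
    S≡ : ∀ {l} j (x : Fin l → Fin n) →
      sum (λ i → g j (x i)) ≡ ι l ℚ.* (proportion (λ i → A? j (x i)) ℚ.- proportion (A? j))
    S≡ {l} j x = begin
      sum (λ i → indicator (A? j (x i)) ℚ.- p)
        ≡⟨ ∑-distrib-+ (λ i → indicator (A? j (x i))) (λ _ → ℚ.- p) ⟩
      sum (λ i → indicator (A? j (x i))) ℚ.+ sum {l} (λ _ → ℚ.- p)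
        ≡⟨ cong₂ ℚ._+_ (sym (proportion-sum (λ i → A? j (x i)))) (sum-const l (ℚ.- p)) ⟩
      y ℚ.* ι l ℚ.+ ι l ℚ.* (ℚ.- p)
        ≡⟨ solve 3 (λ y l p → y :* l :+ l :* (:- p) := l :* (y :- p)) refl y (ι l) p ⟩
      ι l ℚ.* (y ℚ.- p) ∎
      where
      open ≡-Reasoning
      p = proportion (A? j)
      y = proportion (λ i → A? j (x i))

    Σg≡0 : ∀ j → sum (g j) ≡ 0ℚ
    Σg≡0 j = trans (S≡ j id) (trans (cong (ι n ℚ.*_) (ℚ.+-inverseʳ (proportion (A? j)))) (ℚ.*-zeroʳ (ι n)))

    g²≤1 : ∀ j x → square (g j x) ℚ.≤ 1ℚ
    g²≤1 j x = subst (ℚ._≤ 1ℚ) (sym (square-∣∣ (g j x)))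
      (*-mono-≤ {q = 1ℚ} (ℚ.0≤∣p∣ (g j x)) (ℚ.nonNegative⁻¹ 1ℚ) g≤1 g≤1)
      where
      g≤1 = ∣p-q∣≤1 (0≤indicator (A? j x)) (indicator≤1 (A? j x)) (0≤proportion (A? j)) (proportion≤1 (A? j))

    second-moments : sum (λ ω → sum (λ j → square (S j ω))) ℚ.≤ ι m ℚ.* (ι k ℚ.* ι (n ℕ.^ k))
    second-moments = begin
      sum (λ ω → sum (λ j → square (S j ω)))  ≡⟨ ∑-comm (λ ω j → square (S j ω)) ⟩
      sum (λ j → sum (λ ω → square (S j ω)))  ≤⟨ sum-mono (λ j → second-moment (g j) (Σg≡0 j) (g²≤1 j) k) ⟩
      sum {m} (λ _ → ι k ℚ.* ι (n ℕ.^ k))     ≡⟨ sum-const m _ ⟩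
      ι m ℚ.* (ι k ℚ.* ι (n ℕ.^ k))           ∎
      where open ℚ.≤-Reasoning

  -- Chebyshev's inequality and the union bound in one: apply Markov's
  -- inequality to the sum over j of the squared deviations.
  chebyshev : {E : Pred (Fin k → Fin n) 0ℓ} (E? : Decidable E) → ∀ {η c} →
    1 ≤ n → 1 ≤ k → 0ℚ ℚ.< η → ι m ℚ.≤ ι k ℚ.* (square η ℚ.* c) →
    (∀ x → E x → ∃[ j ] η ℚ.≤ ℚ.∣ deviation j x ∣) →
    Prob E? ℚ.≤ c
  chebyshev E? {η} {c} 1≤n 1≤k η>0 m≤ E⇒dev =
    -- Instead of dividing, both sides are multiplied by `ι k * square η` and by `ι k * ι Z`;
    -- `1 ≤ k`, `1 ≤ n` and `0 < η` make these factors positive.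
    *-cancelʳ-≤ (*-pos k>0 (*-pos η>0 η>0)) (*-cancelʳ-≤ (*-pos k>0 Z>0) (begin
      (P ℚ.* (ι k ℚ.* square η)) ℚ.* (ι k ℚ.* ι Z)
        ≡⟨ solve 4 (λ p k e z → (p :* (k :* (e :* e))) :* (k :* z) := (p :* z) :* ((k :* e) :* (k :* e))) refl P (ι k) η (ι Z) ⟩
      (P ℚ.* ι Z) ℚ.* square (ι k ℚ.* η)
        ≡⟨ cong (ℚ._* square (ι k ℚ.* η)) (proportion-sum (λ ω → E? (finToFun {n} {k} ω))) ⟩
      sum (λ ω → indicator (E? (finToFun {n} {k} ω))) ℚ.* square (ι k ℚ.* η)
        ≤⟨ markov (λ ω → E? (finToFun {n} {k} ω)) F _ 0≤F large ⟩
      sum F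
        ≤⟨ second-moments ⟩
      ι m ℚ.* (ι k ℚ.* ι Z)
        ≤⟨ ℚ.*-monoʳ-≤-nonNeg (ι k ℚ.* ι Z) {{ℚ.nonNegative (ℚ.<⇒≤ (*-pos k>0 Z>0))}} m≤ ⟩
      (ι k ℚ.* (square η ℚ.* c)) ℚ.* (ι k ℚ.* ι Z)
        ≡⟨ cong (ℚ._* (ι k ℚ.* ι Z)) (solve 3 (λ k s c → k :* (s :* c) := c :* (k :* s)) refl (ι k) (square η) c) ⟩
      (c ℚ.* (ι k ℚ.* square η)) ℚ.* (ι k ℚ.* ι Z) ∎))
    where
    open ℚ.≤-Reasoning
    Z = n ℕ.^ k
    P = Prob E?
    ι-pos : ∀ {l} → 1 ≤ l → 0ℚ ℚ.< ι l
    ι-pos {suc l} _ = 0<ι l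
    k>0 = ι-pos 1≤k
    Z>0 = ι-pos (ℕ.m^n>0 n {{ℕ.>-nonZero 1≤n}} k)
    F : Fin Z → ℚ
    F ω = sum (λ j → square (S j ω))
    0≤F : ∀ ω → 0ℚ ℚ.≤ F ω
    0≤F ω = sum-nonneg (λ j → 0≤square (S j ω))
    large : ∀ ω → _ → square (ι k ℚ.* η) ℚ.≤ F ω
    large ω e with E⇒dev (finToFun {n} {k} ω) e
    ... | j , η≤ = ℚ.≤-trans (subst (square (ι k ℚ.* η) ℚ.≤_) (sym (square-∣∣ (S j ω)))
            (*-mono-≤ 0≤kη (ℚ.0≤∣p∣ (S j ω)) kη≤ kη≤))
          (term≤sum {f = λ j → square (S j ω)} (λ j → 0≤square (S j ω)) j)
      where
      0≤kη = ℚ.<⇒≤ (*-pos k>0 η>0)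
      kη≤ : ι k ℚ.* η ℚ.≤ ℚ.∣ S j ω ∣
      kη≤ = begin
        ι k ℚ.* η                              ≤⟨ ℚ.*-monoˡ-≤-nonNeg (ι k) {{ℚ.nonNegative (0≤ι k)}} η≤ ⟩
        ι k ℚ.* ℚ.∣ deviation j x ∣            ≡⟨ cong (ℚ._* ℚ.∣ deviation j x ∣) (ℚ.0≤p⇒∣p∣≡p (0≤ι k)) ⟨
        ℚ.∣ ι k ∣ ℚ.* ℚ.∣ deviation j x ∣      ≡⟨ ℚ.∣p*q∣≡∣p∣*∣q∣ (ι k) (deviation j x) ⟨
        ℚ.∣ ι k ℚ.* deviation j x ∣            ≡⟨ cong ℚ.∣_∣ (S≡ j x) ⟨
        ℚ.∣ S j ω ∣                            ∎
        where x = finToFun {n} {k} ω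

-- Numerical codes of rooted graphs and of patterns.

-- This is 2^a (2b + 1), an injection of pairs into the positive integers.
pair : ℕ → ℕ → ℕ
pair zero    b = suc (2 ℕ.* b)
pair (suc a) b = 2 ℕ.* pair a b

-- The first component is the 2-adic valuation: parity tells whether it is zero, and halving lowers
-- it by one.
pair-injective : ∀ a b c d → pair a b ≡ pair c d → a ≡ c × b ≡ d
pair-injective zero    b zero    d eq = refl , ℕ.*-cancelˡ-≡ b d 2 (ℕ.suc-injective eq)
pair-injective zero    b (suc c) d eq = contradiction (sym eq) (ℕ.even≢odd (pair c d) b)
pair-injective (suc a) b zero    d eq = contradiction eq (ℕ.even≢odd (pair a b) d)
pair-injective (suc a) b (suc c) d eq
  with pair-injective a b c d (ℕ.*-cancelˡ-≡ (pair a b) (pair c d) 2 eq)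
... | refl , b≡d = refl , b≡d

-- Serves to bound the radius of a pattern by its key, so that a sampler of large radius sees every
-- pattern of small key.
fst<pair : ∀ a b → a < pair a b
fst<pair zero    b = s≤s z≤n
fst<pair (suc a) b = ℕ.≤-trans (s≤s (fst<pair a b))
  (ℕ.+-mono-≤ (ℕ.≤-trans (s≤s z≤n) (fst<pair a b)) (ℕ.m≤m+n (pair a b) 0))

-- A numeral with `n` digits in base `2 ^ n`, each digit being a row of the matrix in binary.
adjacencyCode : ∀ {n} → (Fin n → Fin n → Bool) → Fin ((2 ℕ.^ n) ℕ.^ n)
adjacencyCode A = funToFin (λ i → funToFin (λ j → Inverse.from 2↔Bool (A i j)))

funToFin-injective : ∀ {m n} (f g : Fin m → Fin n) → funToFin f ≡ funToFin g → ∀ i → f i ≡ g i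
funToFin-injective f g eq i = trans (sym (finToFun-funToFin f i))
  (trans (cong (λ c → finToFun c i) eq) (finToFun-funToFin g i))

adjacencyCode-injective : ∀ {n} (A B : Fin n → Fin n → Bool) →
  adjacencyCode A ≡ adjacencyCode B → ∀ i j → A i j ≡ B i j
adjacencyCode-injective A B eq i j = trans (sym (Inverse.strictlyInverseˡ 2↔Bool (A i j)))
  (trans (cong (Inverse.to 2↔Bool) (funToFin-injective _ _ (funToFin-injective _ _ eq i) j))
    (Inverse.strictlyInverseˡ 2↔Bool (B i j)))

code : RootedGraph → ℕ
code (G rootedAt x) = pair (order G) (pair (toℕ x) (toℕ (adjacencyCode (adjacent G))))

-- Equal codes force equal orders, after which the identity on vertices is an isomorphism. The
-- converse fails: a class can have several codes, one per numbering of the vertices.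
code-≅ᵣ : ∀ A B → code A ≡ code B → A ≅ᵣ B
code-≅ᵣ (record { order = n ; adjacent = A } rootedAt x) (record { order = m ; adjacent = B } rootedAt y) eq
  with refl , eq′ ← pair-injective n _ m _ eq
  with root≡ , adj≡ ← pair-injective (toℕ x) _ (toℕ y) _ eq′ = record
  { iso = record
    { bijection = mk↔ₛ′ id id (λ _ → refl) (λ _ → refl)
    ; preserves = adjacencyCode-injective A B (toℕ-injective adj≡)
    }
  ; preserves-root = toℕ-injective root≡
  }

≅ᵣ-trans : ∀ {A B C} → A ≅ᵣ B → B ≅ᵣ C → A ≅ᵣ C
≅ᵣ-trans φ ψ = record
  { iso = record
    { bijection = ψ.bijection ↔-∘ φ.bijection
    ; preserves = λ x y → trans (φ.preserves x y) (ψ.preserves (φ.to x) (φ.to y))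
    }
  ; preserves-root = trans (cong ψ.to φ.preserves-root) ψ.preserves-root
  }
  where
  module φ = _≅ᵣ_ φ
  module ψ = _≅ᵣ_ ψ

proportion-cong : ∀ {n} {P Q : Pred (Fin n) 0ℓ} (P? : Decidable P) (Q? : Decidable Q) →
  (∀ {x} → P x → Q x) → (∀ {x} → Q x → P x) → proportion P? ≡ proportion Q?
proportion-cong {zero}  P? Q? P⊆Q Q⊆P = refl
proportion-cong {suc n} P? Q? P⊆Q Q⊆P =
  cong (λ xs → + length xs ℚ./ suc n) (filter-≐ P? Q? (P⊆Q , Q⊆P) (allFin (suc n)))

-- The radius is recorded because frequencies count balls of exactly that radius; with the code it
-- determines the frequency in every graph.
key : ∀ {r d} → U r d → ℕ
key {r} α = pair r (code (rootedGraph α))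

frequency-key : ∀ {r s d} (G : Graph) (α : U r d) (β : U s d) →
  key α ≡ key β → frequency G α ≡ frequency G β
frequency-key {r} {s} G α β eq
  with refl , eq′ ← pair-injective r (code (rootedGraph α)) s (code (rootedGraph β)) eq =
  proportion-cong (λ x → ball G r x ≅ᵣ? rootedGraph α) (λ x → ball G r x ≅ᵣ? rootedGraph β)
    (λ φ → ≅ᵣ-trans φ (code-≅ᵣ (rootedGraph α) (rootedGraph β) eq′))
    (λ φ → ≅ᵣ-trans φ (code-≅ᵣ (rootedGraph β) (rootedGraph α) (sym eq′)))

-- Infinite sets of indices and the diagonal argument.

Eventually : (ℕ → Set) → Set
Eventually P = ∃[ N ] (∀ n → N ≤ n → P n)

eventually-map : ∀ {P Q : ℕ → Set} → (∀ n → P n → Q n) → Eventually P → Eventually Q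
eventually-map P⊆Q (N , p) = N , λ n N≤n → P⊆Q n (p n N≤n)

module _ (em : ExcludedMiddle 0ℓ) where

  Infinite : (ℕ → Set) → Set
  Infinite P = ∀ m → ∃[ n ] (m ≤ n × P n)

  decisive-subset : ∀ {P : ℕ → Set} (Q : ℕ → Set) → Infinite P →
    Σ[ P′ ∈ (ℕ → Set) ] (Infinite P′ × P′ ⊆ P × (P′ ⊆ Q ⊎ P′ ⊆ ∁ Q))
  decisive-subset {P} Q inf with em {Infinite (P ∩ Q)}
  ... | yes Q-inf = P ∩ Q , Q-inf , proj₁ , inj₁ proj₂
  ... | no ¬Q-inf = P ∩ ∁ Q , rest-inf , proj₁ , inj₂ proj₂
    where
    rest-inf : Infinite (P ∩ ∁ Q)
    -- If no element of `P` from `m` on avoided `Q`, then every element of `P` past `l ⊔ m` would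
    -- lie in `Q`, and `P ∩ Q` would be infinite.
    rest-inf m = decidable-stable em λ none → ¬Q-inf λ l →
      let n , l⊔m≤n , p = inf (l ℕ.⊔ m) in
      n , ℕ.m⊔n≤o⇒m≤o l m l⊔m≤n , p ,
      decidable-stable em λ ¬q → none (n , ℕ.m⊔n≤o⇒n≤o l m l⊔m≤n , p , ¬q)

  -- Decide the predicates one after the other, each time keeping an infinite
  -- set of indices, and pick the n-th index from the n-th set.
  decisive-subsequence : (c : ℕ → ℕ → Set) → ∃[ φ ] ((∀ n → n ≤ φ n) ×
    (∀ j → Eventually (c j ∘ φ) ⊎ Eventually (∁ (c j) ∘ φ)))
  decisive-subsequence c = φ , (λ n → proj₁ (proj₂ (pick n))) , decided
    where
    Stage : Set₁
    Stage = Σ[ P ∈ (ℕ → Set) ] Infinite P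

    stage : ℕ → Stage

    refined : ∀ j → Σ[ P′ ∈ (ℕ → Set) ]
      (Infinite P′ × P′ ⊆ proj₁ (stage j) × (P′ ⊆ c j ⊎ P′ ⊆ ∁ (c j)))
    refined j = decisive-subset (c j) (proj₂ (stage j))

    stage zero    = (λ n → n ≡ n) , λ m → m , ℕ.≤-refl , refl
    stage (suc j) = proj₁ (refined j) , proj₁ (proj₂ (refined j))

    In : ℕ → ℕ → Set
    In j = proj₁ (stage j)

    pick : ∀ n → ∃[ m ] (n ≤ m × In n m)
    pick n = proj₂ (stage n) n

    -- The picks need not increase; `n ≤ φ n` is what carries tails to tails.
    φ : ℕ → ℕ
    φ n = proj₁ (pick n)

    In-antitone : ∀ {i j n} → i ℕ.≤′ j → In j n → In i n
    In-antitone (ℕ.≤′-reflexive refl)  = id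
    In-antitone (ℕ.≤′-step {j} i≤j) = In-antitone i≤j ∘ proj₁ (proj₂ (proj₂ (refined j)))

    -- `c j` is decided on stage `suc j`, and the stages shrink, so all picks from index `suc j` on
    -- agree about it.
    late : ∀ j n → suc j ≤ n → In (suc j) (φ n)
    late j n j<n = In-antitone (ℕ.≤⇒≤′ j<n) (proj₂ (proj₂ (pick n)))

    decided : ∀ j → Eventually (c j ∘ φ) ⊎ Eventually (∁ (c j) ∘ φ)
    decided j = Sum.map (λ h → suc j , λ n j<n → h (late j n j<n))
      (λ h → suc j , λ n j<n → h (late j n j<n)) (proj₂ (proj₂ (proj₂ (refined j))))

-- Distances of rationals and convergence of frequencies.

½*-pos : ∀ {ε} → 0ℚ ℚ.< ε → 0ℚ ℚ.< ½ ℚ.* ε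
½*-pos = *-pos (ℚ.positive⁻¹ ½)

½+½ : ∀ ε → ½ ℚ.* ε ℚ.+ ½ ℚ.* ε ≡ ε
½+½ ε = trans (sym (ℚ.*-distribʳ-+ ε ½ ½)) (ℚ.*-identityˡ ε)

½*< : ∀ {ε} → 0ℚ ℚ.< ε → ½ ℚ.* ε ℚ.< ε
½*< {ε} ε>0 = subst₂ ℚ._<_ (ℚ.+-identityˡ (½ ℚ.* ε)) (½+½ ε) (ℚ.+-monoˡ-< (½ ℚ.* ε) (½*-pos ε>0))

∣-∣-sym : ∀ p q → ℚ.∣ p ℚ.- q ∣ ≡ ℚ.∣ q ℚ.- p ∣
∣-∣-sym p q = trans (sym (ℚ.∣-p∣≡∣p∣ (p ℚ.- q)))
  (cong ℚ.∣_∣ (solve 2 (λ p q → :- (p :- q) := q :- p) refl p q))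

∣-∣-triangle : ∀ p q r → ℚ.∣ p ℚ.- r ∣ ℚ.≤ ℚ.∣ p ℚ.- q ∣ ℚ.+ ℚ.∣ q ℚ.- r ∣
∣-∣-triangle p q r = subst (λ t → ℚ.∣ t ∣ ℚ.≤ ℚ.∣ p ℚ.- q ∣ ℚ.+ ℚ.∣ q ℚ.- r ∣)
  (solve 3 (λ p q r → (p :- q) :+ (q :- r) := p :- r) refl p q r)
  (ℚ.∣p+q∣≤∣p∣+∣q∣ (p ℚ.- q) (q ℚ.- r))

p≤q+c⇒p-q≤c : ∀ {p q c} → p ℚ.≤ q ℚ.+ c → p ℚ.- q ℚ.≤ c
p≤q+c⇒p-q≤c {p} {q} {c} p≤q+c = subst (p ℚ.- q ℚ.≤_)
  (solve 2 (λ q c → (q :+ c) :- q := c) refl q c) (ℚ.+-monoˡ-≤ (ℚ.- q) p≤q+c)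

∣-∣≤ : ∀ {p q c} → p ℚ.≤ q ℚ.+ c → q ℚ.≤ p ℚ.+ c → ℚ.∣ p ℚ.- q ∣ ℚ.≤ c
∣-∣≤ {p} {q} {c} p≤ q≤ with ℚ.∣p∣≡p∨∣p∣≡-p (p ℚ.- q)
... | inj₁ eq = subst (ℚ._≤ c) (sym eq) (p≤q+c⇒p-q≤c p≤)
... | inj₂ eq = subst (ℚ._≤ c) (trans (solve 2 (λ p q → q :- p := :- (p :- q)) refl p q) (sym eq))
  (p≤q+c⇒p-q≤c q≤)

-- Scanning the grid of width τ M from 0 to 1 locates the sequence in a cell.
decided-thresholds⇒cauchy : (a : ℕ → ℚ) → (∀ n → 0ℚ ℚ.≤ a n) → (∀ n → a n ℚ.≤ 1ℚ) →
  (∀ k m → Eventually (λ n → a n ℚ.≤ ι k ℚ.* τ m) ⊎ Eventually (λ n → ¬ a n ℚ.≤ ι k ℚ.* τ m)) →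
  IsCauchy a
decided-thresholds⇒cauchy a 0≤a a≤1 decided ε ε>0 = [ located⇒cauchy , top ]′ (scan (suc M))
  where
  -- Cells are closed, so their width is at most half of `ε` to make the final bound strict.
  M = proj₁ (τ-vanishes (½*-pos ε>0))
  w = τ M

  CauchyAt : Set
  CauchyAt = ∃[ N ] (∀ m n → N ≤ m → N ≤ n → ℚ.∣ a m ℚ.- a n ∣ ℚ.< ε)

  Located : Set
  Located = ∃[ l ] Eventually (λ n → l ℚ.≤ a n × a n ℚ.≤ l ℚ.+ w)

  next : ∀ k → ι k ℚ.* w ℚ.+ w ≡ ι (suc k) ℚ.* w
  next k = trans (solve 2 (λ a w → a :* w :+ w := (con 1ℚ :+ a) :* w) refl (ι k) w)
    (cong (ℚ._* w) (sym (ι-suc k)))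

  scan : ∀ k → Located ⊎ Eventually (λ n → ι k ℚ.* w ℚ.≤ a n)
  scan zero    = inj₂ (0 , λ n _ → subst (ℚ._≤ a n) (sym (ι0*p≡0 w)) (0≤a n))
  scan (suc k) with scan k
  ... | inj₁ l = inj₁ l
  ... | inj₂ (N , above) with decided (suc k) M
  ...   | inj₁ (N′ , below) = inj₁ (ι k ℚ.* w , N ℕ.⊔ N′ , λ n ≤n →
          above n (ℕ.m⊔n≤o⇒m≤o N N′ ≤n) ,
          subst (a n ℚ.≤_) (sym (next k)) (below n (ℕ.m⊔n≤o⇒n≤o N N′ ≤n)))
  ...   | inj₂ (N′ , ¬below) = inj₂ (N′ , λ n N′≤n → ℚ.<⇒≤ (ℚ.≰⇒> (¬below n N′≤n)))

  located⇒cauchy : Located → CauchyAt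
  located⇒cauchy (l , N , cell) = N , λ m n N≤m N≤n → ℚ.≤-<-trans
    (ℚ.≤-trans (∣-∣≤ {a m} {a n}
      (ℚ.≤-trans (proj₂ (cell m N≤m)) (ℚ.+-monoˡ-≤ w (proj₁ (cell n N≤n))))
      (ℚ.≤-trans (proj₂ (cell n N≤n)) (ℚ.+-monoˡ-≤ w (proj₁ (cell m N≤m)))))
      (proj₂ (τ-vanishes (½*-pos ε>0)) M ℕ.≤-refl))
    (½*< ε>0)

  -- The `suc M` cells of width `τ M` end exactly at 1, and `a n ≤ 1` places the sequence in the
  -- next cell, which starts there.
  top : Eventually (λ n → ι (suc M) ℚ.* w ℚ.≤ a n) → CauchyAt
  top (N , above) = located⇒cauchy (1ℚ , N , λ n N≤n →
    subst (ℚ._≤ a n) (ι*τ≡1 M) (above n N≤n) ,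
    ℚ.≤-trans (a≤1 n) (subst (ℚ._≤ 1ℚ ℚ.+ w) (ℚ.+-identityʳ 1ℚ) (ℚ.+-monoʳ-≤ 1ℚ (ℚ.<⇒≤ (0<τ M)))))

-- All comparisons of a frequency with a grid point `ι k * τ m` are numbered by
-- `pair (key α) (pair k m)` and decided along one subsequence.
convergent-subsequence : ExcludedMiddle 0ℓ → ∀ {d} (G : ℕ → Graph) → ∃[ φ ] ((∀ n → n ≤ φ n) ×
  (∀ {r} (α : U r d) → IsCauchy (λ n → frequency (G (φ n)) α)))
convergent-subsequence em {d} G = φ , proj₁ (proj₂ subsequence) , λ {r} α →
  decided-thresholds⇒cauchy (λ n → frequency (G (φ n)) α)
    (λ n → 0≤proportion (λ x → ball (G (φ n)) r x ≅ᵣ? rootedGraph α))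
    (λ n → proportion≤1 (λ x → ball (G (φ n)) r x ≅ᵣ? rootedGraph α))
    (λ k m → Sum.map (eventually-map (sound α k m)) (eventually-map (λ n ¬c → ¬c ∘ complete α k m n))
      (proj₂ (proj₂ subsequence) (pair (key α) (pair k m))))
  where
  Below : ∀ {r} → U r d → ℕ → ℕ → ℕ → Set
  Below α k m n = frequency (G n) α ℚ.≤ ι k ℚ.* τ m

  -- Quantifying over everything coded by `j` replaces decoding; by `frequency-key` all patterns
  -- with the same key give the same comparison.
  Coded : ℕ → ℕ → Set
  Coded j n = ∃[ r ] Σ[ α ∈ U r d ] ∃[ k ] ∃[ m ] (pair (key α) (pair k m) ≡ j × Below α k m n)

  subsequence = decisive-subsequence em Coded
  φ = proj₁ subsequence

  Below-key : ∀ {r s} (α : U r d) (β : U s d) {k l m o n} →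
    key β ≡ key α × (l ≡ k × o ≡ m) → Below β l o n → Below α k m n
  Below-key α β {k} {m = m} {n = n} (eq , refl , refl) =
    subst (ℚ._≤ ι k ℚ.* τ m) (frequency-key (G n) β α eq)

  sound : ∀ {r} (α : U r d) k m n → Coded (pair (key α) (pair k m)) (φ n) → Below α k m (φ n)
  sound α k m n (s , β , l , o , eq , h) =
    let eq₁ , eq₂ = pair-injective (key β) (pair l o) (key α) (pair k m) eq
    in Below-key α β {n = φ n} (eq₁ , pair-injective l o k m eq₂) h

  complete : ∀ {r} (α : U r d) k m n → Below α k m (φ n) → Coded (pair (key α) (pair k m)) (φ n)
  complete {r} α k m n h = r , α , k , m , refl , h

-- Closeness and convergence of reals through rational bounds.

-- Stated termwise without slack, so it implies `∣ x -ℝ y ∣ℝ ≤ℝ fromℚ ε`.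
Within : ℚ → ℝ → ℝ → Set
Within ε x y = Eventually (λ n → ℚ.∣ seq x n ℚ.- seq y n ∣ ℚ.≤ ε)

positive-below : ∀ ε → 0ℝ <ℝ ε → ∃[ q ] (0ℚ ℚ.< q × Eventually (λ n → q ℚ.≤ seq ε n))
positive-below ε (q , q>0 , N , h) = q , q>0 , N , λ n N≤n →
  subst (ℚ._≤ seq ε n) (ℚ.+-identityˡ q) (h n N≤n)

cauchy⇒convergent : ∀ a → IsCauchy a → Convergent (fromℚ ∘ a)
-- The sequence itself represents its limit. One half of `q` bounds the distance and the other is
-- the margin that `<ℝ` asks for.
cauchy⇒convergent a ca = mkℝ a ca , λ ε ε>0 →
  let q , q>0 , M , q≤ε = positive-below ε ε>0
      N , close = ca (½ ℚ.* q) (½*-pos q>0)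
  in N , λ n N≤n → ½ ℚ.* q , ½*-pos q>0 , N ℕ.⊔ M , λ m ≤m → ℚ.≤-trans
    (subst (ℚ.∣ a n ℚ.- a m ∣ ℚ.+ ½ ℚ.* q ℚ.≤_) (½+½ q)
      (ℚ.+-monoˡ-≤ (½ ℚ.* q) (ℚ.<⇒≤ (close n m N≤n (ℕ.m⊔n≤o⇒m≤o N M ≤m)))))
    (q≤ε m (ℕ.m⊔n≤o⇒n≤o N M ≤m))

convergent⇒cauchy : ∀ a → Convergent a → ∀ {ε} → 0ℚ ℚ.< ε →
  ∃[ N ] (∀ m n → N ≤ m → N ≤ n → Within ε (a m) (a n))
convergent⇒cauchy a (L , a→L) {ε} ε>0 =
  let N , near = a→L (fromℚ (½ ℚ.* ε)) (½ ℚ.* ε , ½*-pos ε>0 , 0 ,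
        λ _ _ → ℚ.≤-reflexive (ℚ.+-identityˡ (½ ℚ.* ε)))
  in N , λ m n N≤m N≤n →
    let q , q>0 , M , h = near m N≤m
        r , r>0 , K , k = near n N≤n
    in M ℕ.⊔ K , λ l ≤l → begin
      ℚ.∣ seq (a m) l ℚ.- seq (a n) l ∣
        ≤⟨ ∣-∣-triangle (seq (a m) l) (seq L l) (seq (a n) l) ⟩
      ℚ.∣ seq (a m) l ℚ.- seq L l ∣ ℚ.+ ℚ.∣ seq L l ℚ.- seq (a n) l ∣
        ≡⟨ cong (ℚ.∣ seq (a m) l ℚ.- seq L l ∣ ℚ.+_) (∣-∣-sym (seq L l) (seq (a n) l)) ⟩
      ℚ.∣ seq (a m) l ℚ.- seq L l ∣ ℚ.+ ℚ.∣ seq (a n) l ℚ.- seq L l ∣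
        ≤⟨ ℚ.+-mono-≤ (drop ℚ.∣ seq (a m) l ℚ.- seq L l ∣ q>0 (h l (ℕ.m⊔n≤o⇒m≤o M K ≤l))) (drop ℚ.∣ seq (a n) l ℚ.- seq L l ∣ r>0 (k l (ℕ.m⊔n≤o⇒n≤o M K ≤l))) ⟩
      ½ ℚ.* ε ℚ.+ ½ ℚ.* ε
        ≡⟨ ½+½ ε ⟩
      ε ∎
  where
  open ℚ.≤-Reasoning
  drop : ∀ p {q r} → 0ℚ ℚ.< q → p ℚ.+ q ℚ.≤ r → p ℚ.≤ r
  drop p {q} {r} q>0 p+q≤r = ℚ.≤-trans
    (subst (ℚ._≤ p ℚ.+ q) (ℚ.+-identityʳ p) (ℚ.+-monoʳ-≤ p (ℚ.<⇒≤ q>0))) p+q≤r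

-- Interleaved sequences.

interleave : {A : Set} → (ℕ → A) → (ℕ → A) → ℕ → A
interleave g h zero          = g zero
interleave g h (suc zero)    = h zero
interleave g h (suc (suc n)) = interleave (g ∘ suc) (h ∘ suc) n

module _ {A : Set} where

  interleave-even : ∀ (g h : ℕ → A) n → interleave g h (n ℕ.+ n) ≡ g n
  interleave-even g h zero    = refl
  interleave-even g h (suc n) rewrite ℕ.+-suc n n = interleave-even (g ∘ suc) (h ∘ suc) n

  interleave-odd : ∀ (g h : ℕ → A) n → interleave g h (suc (n ℕ.+ n)) ≡ h n
  interleave-odd g h zero    = refl
  interleave-odd g h (suc n) rewrite ℕ.+-suc n n = interleave-odd (g ∘ suc) (h ∘ suc) n

  -- Term `n` of the interleaving is term `⌊ n /2⌋` of one of the two sequences, so indexed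
  -- properties shared by both transfer without a parity split.
  interleave-cases : ∀ (g h : ℕ → A) (P : ℕ → A → Set) →
    (∀ n → P n (g n)) → (∀ n → P n (h n)) → ∀ n → P ⌊ n /2⌋ (interleave g h n)
  interleave-cases g h P Pg Ph zero          = Pg zero
  interleave-cases g h P Pg Ph (suc zero)    = Ph zero
  interleave-cases g h P Pg Ph (suc (suc n)) =
    interleave-cases (g ∘ suc) (h ∘ suc) (P ∘ suc) (Pg ∘ suc) (Ph ∘ suc) n

⌊n/2⌋-unbounded : ∀ m {n} → m ℕ.+ m ≤ n → m ≤ ⌊ n /2⌋
⌊n/2⌋-unbounded m {n} 2m≤n = subst (_≤ ⌊ n /2⌋) (sym (ℕ.n≡⌊n+n/2⌋ m)) (ℕ.⌊n/2⌋-mono 2m≤n)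

cauchy-perturb : ∀ a u → IsCauchy a →
  (∀ η → 0ℚ ℚ.< η → Eventually (λ n → ℚ.∣ u n ℚ.- a ⌊ n /2⌋ ∣ ℚ.≤ η)) → IsCauchy u
cauchy-perturb a u ca u≈a ε ε>0 =
  -- A quarter of `ε` pays for each of the two replacements of `u` by `a`, and half for the Cauchy
  -- bound on `a`.
  let η = ½ ℚ.* (½ ℚ.* ε)
      N , close = ca (½ ℚ.* ε) (½*-pos ε>0)
      M , near = u≈a η (½*-pos (½*-pos ε>0))
  in (N ℕ.+ N) ℕ.⊔ M , λ m n ≤m ≤n →
    let near-m = near m (ℕ.m⊔n≤o⇒n≤o (N ℕ.+ N) M ≤m)
        near-n = near n (ℕ.m⊔n≤o⇒n≤o (N ℕ.+ N) M ≤n)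
        am = a ⌊ m /2⌋
        an = a ⌊ n /2⌋
    in begin-strict
      ℚ.∣ u m ℚ.- u n ∣
        ≤⟨ ∣-∣-triangle (u m) an (u n) ⟩
      ℚ.∣ u m ℚ.- an ∣ ℚ.+ ℚ.∣ an ℚ.- u n ∣
        ≤⟨ ℚ.+-mono-≤ (∣-∣-triangle (u m) am an) (subst (ℚ._≤ η) (∣-∣-sym (u n) an) near-n) ⟩
      (ℚ.∣ u m ℚ.- am ∣ ℚ.+ ℚ.∣ am ℚ.- an ∣) ℚ.+ η
        <⟨ ℚ.+-monoˡ-< η (ℚ.+-mono-≤-< near-m (close ⌊ m /2⌋ ⌊ n /2⌋
             (⌊n/2⌋-unbounded N (ℕ.m⊔n≤o⇒m≤o (N ℕ.+ N) M ≤m))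
             (⌊n/2⌋-unbounded N (ℕ.m⊔n≤o⇒m≤o (N ℕ.+ N) M ≤n)))) ⟩
      (η ℚ.+ ½ ℚ.* ε) ℚ.+ η
        ≡⟨ trans (cong (ℚ._+ η) (ℚ.+-comm η (½ ℚ.* ε))) (ℚ.+-assoc (½ ℚ.* ε) η η) ⟩
      ½ ℚ.* ε ℚ.+ (η ℚ.+ η)
        ≡⟨ cong (½ ℚ.* ε ℚ.+_) (½+½ (½ ℚ.* ε)) ⟩
      ½ ℚ.* ε ℚ.+ ½ ℚ.* ε
        ≡⟨ ½+½ ε ⟩
      ε ∎
  where open ℚ.≤-Reasoning

-- Uniform continuity in the neighbourhood frequencies.

-- One parameter governs both the range of patterns and the tolerance, so a single sequence of
-- counterexamples improves in both respects.
Indistinguishable : ℕ → ℕ → Graph → Graph → Set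
Indistinguishable d n G H = ∀ {r} (α : U r d) → 1 ≤ r → key α ≤ n →
  ℚ.∣ frequency G α ℚ.- frequency H α ∣ ℚ.≤ τ n

module _ (em : ExcludedMiddle 0ℓ) {d f} (ζ : Parameter d f) (continuous : Continuous ζ) where

  private
    Counterexample : ℚ → ℕ → Set
    Counterexample ε n = Σ[ G ∈ Graphᵈᶠ d f ] Σ[ H ∈ Graphᵈᶠ d f ]
      (n ≤ order (underlying G) × n ≤ order (underlying H) ×
       Indistinguishable d n (underlying G) (underlying H) ×
       ¬ Within ε (value ζ G) (value ζ H))

  ¬counterexamples : ∀ {ε} → 0ℚ ℚ.< ε → ¬ (∀ n → Counterexample ε n)
  ¬counterexamples {ε} ε>0 bad = proj₂ (proj₂ (proj₂ (proj₂ (proj₂ (bad (φ N))))))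
    -- The consecutive terms `N + N` and `suc (N + N)` of `K` are `G N` and `H N`, a pair that `bad`
    -- keeps apart.
    (subst₂ (λ G H → Within ε (value ζ G) (value ζ H))
      (interleave-even G H N) (interleave-odd G H N)
      (proj₂ ζ-cauchy (N ℕ.+ N) (suc (N ℕ.+ N)) (ℕ.m≤m+n N N) (ℕ.m≤n⇒m≤1+n (ℕ.m≤m+n N N))))
    where
    G₀ H₀ : ℕ → Graphᵈᶠ d f
    G₀ n = proj₁ (bad n)
    H₀ n = proj₁ (proj₂ (bad n))
    -- Only the first graphs are made convergent; the frequencies of their partners follow by
    -- indistinguishability.
    subsequence = convergent-subsequence em {d} (underlying ∘ G₀)
    φ = proj₁ subsequence
    n≤φ = proj₁ (proj₂ subsequence)
    G H K : ℕ → Graphᵈᶠ d f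
    G = G₀ ∘ φ
    H = H₀ ∘ φ
    K = interleave G H

    K-large : ∀ n → ⌊ n /2⌋ ≤ order (underlying (K n))
    K-large = interleave-cases G H (λ n F → n ≤ order (underlying F))
      (λ n → ℕ.≤-trans (n≤φ n) (proj₁ (proj₂ (proj₂ (bad (φ n))))))
      (λ n → ℕ.≤-trans (n≤φ n) (proj₁ (proj₂ (proj₂ (proj₂ (bad (φ n)))))))

    K-near-G : ∀ {r} (α : U r d) → 1 ≤ r → ∀ n → key α ≤ ⌊ n /2⌋ →
      ℚ.∣ frequency (underlying (K n)) α ℚ.- frequency (underlying (G ⌊ n /2⌋)) α ∣ ℚ.≤ τ (φ ⌊ n /2⌋)
    K-near-G α 1≤r = interleave-cases G H
      (λ n F → key α ≤ n → ℚ.∣ frequency (underlying F) α ℚ.- frequency (underlying (G n)) α ∣ ℚ.≤ τ (φ n))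
      (λ n _ → subst (ℚ._≤ τ (φ n)) (sym (cong ℚ.∣_∣ (ℚ.+-inverseʳ (frequency (underlying (G n)) α))))
        (ℚ.<⇒≤ (0<τ (φ n))))
      (λ n key≤n → subst (ℚ._≤ τ (φ n))
        (∣-∣-sym (frequency (underlying (G n)) α) (frequency (underlying (H n)) α))
        (proj₁ (proj₂ (proj₂ (proj₂ (proj₂ (bad (φ n)))))) α 1≤r (ℕ.≤-trans key≤n (n≤φ n))))

    K-cauchy : ∀ {r} (α : U r d) → 1 ≤ r → IsCauchy (λ n → frequency (underlying (K n)) α)
    K-cauchy α 1≤r = cauchy-perturb (λ n → frequency (underlying (G n)) α)
      (λ n → frequency (underlying (K n)) α)
      (proj₂ (proj₂ subsequence) α) λ η η>0 →
        let M , small = τ-vanishes η>0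
            -- From `m` on the tolerance is at most `η` and `α` is among the compared patterns;
            -- doubling `m` makes up for the halved index.
            m = M ℕ.⊔ key α
        in m ℕ.+ m , λ n 2m≤n →
          let m≤ = ⌊n/2⌋-unbounded m 2m≤n
          in ℚ.≤-trans (K-near-G α 1≤r n (ℕ.m⊔n≤o⇒n≤o M (key α) m≤))
            (small (φ ⌊ n /2⌋) (ℕ.≤-trans (ℕ.m⊔n≤o⇒m≤o M (key α) m≤) (n≤φ ⌊ n /2⌋)))

    ζ-cauchy = convergent⇒cauchy (value ζ ∘ K) (continuous K record
      { unbounded  = λ M → M ℕ.+ M , λ n 2M≤n → ℕ.≤-trans (⌊n/2⌋-unbounded M 2M≤n) (K-large n)
      ; statistics = λ r 1≤r α → cauchy⇒convergent (λ n → frequency (underlying (K n)) α) (K-cauchy α 1≤r)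
      }) ε>0
    N = proj₁ ζ-cauchy

  -- If no `n` worked, each `n` would fail for some pair; `em` decides the type `Counterexample ε n`
  -- itself and so yields actual pairs.
  modulus : ∀ {ε} → 0ℚ ℚ.< ε → ∃[ n ] (∀ G H →
    n ≤ order (underlying G) → n ≤ order (underlying H) →
    Indistinguishable d n (underlying G) (underlying H) →
    Within ε (value ζ G) (value ζ H))
  modulus {ε} ε>0 = decidable-stable em λ none → ¬counterexamples ε>0 λ n →
    decidable-stable em λ ¬bad → none (n , λ G H n≤G n≤H G≈H →
      decidable-stable em λ far → ¬bad (G , H , n≤G , n≤H , (λ {r} → G≈H {r}) , far))

-- The tester and its failure probability.

≃ℝ-reflexive : ∀ {x y} → x ≡ y → x ≃ℝ y
≃ℝ-reflexive {x} refl q q>0 = 0 , λ n _ →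
  subst (ℚ._≤ q) (sym (cong ℚ.∣_∣ (ℚ.+-inverseʳ (seq x n)))) (ℚ.<⇒≤ q>0)

within⇒≮ : ∀ {ε q x y} → Eventually (λ n → q ℚ.≤ seq ε n) → Within q x y → ¬ ε <ℝ ∣ x -ℝ y ∣ℝ
within⇒≮ {ε} {q} (M , q≤ε) (N , close) (r , r>0 , K , h) =
  ℚ.<-irrefl refl (ℚ.<-≤-trans
    (subst (ℚ._< seq ε n ℚ.+ r) (ℚ.+-identityʳ (seq ε n)) (ℚ.+-monoʳ-< (seq ε n) r>0))
    (ℚ.≤-trans (h n (ℕ.m≤n⊔m (M ℕ.⊔ N) K))
      (ℚ.≤-trans (close n (ℕ.m⊔n≤o⇒n≤o M N MN≤n)) (q≤ε n (ℕ.m⊔n≤o⇒m≤o M N MN≤n)))))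
  where
  n = (M ℕ.⊔ N) ℕ.⊔ K
  MN≤n = ℕ.m≤m⊔n (M ℕ.⊔ N) K

-- Reduces the patterns of bounded key to a finite list: for each key value in turn, excluded middle
-- supplies one element with that key or shows that there is none.
representatives : ExcludedMiddle 0ℓ → {A : Set} (k : A → ℕ) → ∀ n →
  Σ[ xs ∈ List A ] (∀ a → k a < n → Any (λ b → k b ≡ k a) xs)
representatives em k zero = [] , λ _ ()
representatives em {A} k (suc n) with representatives em k n | em {Σ[ a ∈ A ] k a ≡ n}
... | xs , covers | yes (b , kb≡n) = b ∷ xs , λ a ka<1+n →
  [ there ∘ covers a , (λ ka≡n → here (trans kb≡n (sym ka≡n))) ]′ (ℕ.m≤n⇒m<n∨m≡n (ℕ.≤-pred ka<1+n))
... | xs , covers | no none = xs , λ a ka<1+n →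
  covers a (ℕ.≤∧≢⇒< (ℕ.≤-pred ka<1+n) (λ ka≡n → none (a , ka≡n)))

module _ {R d : ℕ} where

  Occurs : (G : Graph) → Pattern R d → Vertex G → Set
  Occurs G (s , _ , _ , α) x = ball G s x ≅ᵣ rootedGraph α

  occurs? : ∀ G p → Decidable (Occurs G p)
  occurs? G (s , _ , _ , α) x = ball G s x ≅ᵣ? rootedGraph α

  patternFrequency : Graph → Pattern R d → ℚ
  patternFrequency G p = proportion (occurs? G p)

  patternKey : Pattern R d → ℕ
  patternKey (_ , _ , _ , α) = key α

module _ (em : ExcludedMiddle 0ℓ) {d f} (ζ : Parameter d f) (n : ℕ) where

  private
    -- Half the tolerance, since two graphs that fit the same vector are compared through it.
    η : ℚ
    η = ½ ℚ.* τ n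

    represented : Σ[ ps ∈ List (Pattern (suc n) d) ]
      (∀ p → patternKey p < suc n → Any (λ p′ → patternKey p′ ≡ patternKey p) ps)
    represented = representatives em patternKey (suc n)

    ps : List (Pattern (suc n) d)
    ps = proj₁ represented

    m : ℕ
    m = length ps

    pattern-at : Fin m → Pattern (suc n) d
    pattern-at = List.lookup ps

    Fits : Vec ℚ m → Graph → Set
    Fits v H = ∀ j → ℚ.∣ Vec.lookup v j ℚ.- patternFrequency H (pattern-at j) ∣ ℚ.≤ η

    Fitting : Vec ℚ m → Set
    Fitting v = Σ[ H ∈ Graphᵈᶠ d f ] (n ≤ order (underlying H) × Fits v (underlying H))

    guess : (v : Vec ℚ m) → Dec (Fitting v) → ℝ
    guess v (yes (H , _)) = value ζ H
    -- A default for vectors that no large graph fits; whenever the sampled graph itself fits, this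
    -- case is excluded.
    guess v (no _)        = 0ℝ

    restrict : Distribution (suc n) d → Vec ℚ m
    restrict Y = Vec.tabulate (Y ∘ pattern-at)

  -- Passing through a vector makes the choice of the fitting graph depend only
  -- on the values of the distribution.
  nearestTester : Tester (suc n) d
  nearestTester = record
    { calculate   = λ Y → guess (restrict Y) em
    ; extensional = λ Y Y′ Y≗Y′ →
        ≃ℝ-reflexive (cong (λ v → guess v em) (tabulate-cong (Y≗Y′ ∘ pattern-at)))
    }

  private
    fits⇒indistinguishable : ∀ v G H → Fits v G → Fits v H → Indistinguishable d n G H
    fits⇒indistinguishable v G H G-fits H-fits {r} α 1≤r key≤n = begin
      ℚ.∣ frequency G α ℚ.- frequency H α ∣
        ≡⟨ cong₂ (λ a b → ℚ.∣ a ℚ.- b ∣) (frequency-key G α β key≡) (frequency-key H α β key≡) ⟩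
      ℚ.∣ g ℚ.- h ∣
        ≤⟨ ∣-∣-triangle g y h ⟩
      ℚ.∣ g ℚ.- y ∣ ℚ.+ ℚ.∣ y ℚ.- h ∣
        ≤⟨ ℚ.+-mono-≤ (subst (ℚ._≤ η) (∣-∣-sym y g) (G-fits j)) (H-fits j) ⟩
      η ℚ.+ η
        ≡⟨ ½+½ (τ n) ⟩
      τ n ∎
      where
      open ℚ.≤-Reasoning
      p : Pattern (suc n) d
      p = r , 1≤r , ℕ.≤-trans (ℕ.<⇒≤ (fst<pair r (code (rootedGraph α)))) (ℕ.m≤n⇒m≤1+n key≤n) , α
      found = proj₂ represented p (s≤s key≤n)
      j = Any.index found
      -- The listed representative with the key of `α`; it has the same frequencies.
      β = proj₂ (proj₂ (proj₂ (pattern-at j)))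
      key≡ : key α ≡ key β
      key≡ = sym (lookup-index found)
      g = patternFrequency G (pattern-at j)
      h = patternFrequency H (pattern-at j)
      y = Vec.lookup v j

  module _ {q : ℚ} (ζ-modulus : ∀ G H →
    n ≤ order (underlying G) → n ≤ order (underlying H) →
    Indistinguishable d n (underlying G) (underlying H) → Within q (value ζ G) (value ζ H)) where

    guess-within : ∀ v (G : Graphᵈᶠ d f) (fitting? : Dec (Fitting v)) → n ≤ order (underlying G) →
      Fits v (underlying G) → Within q (guess v fitting?) (value ζ G)
    guess-within v G (yes (H , n≤H , H-fits)) n≤G G-fits = ζ-modulus H G n≤H n≤G
      λ {r} → fits⇒indistinguishable v (underlying H) (underlying G) H-fits G-fits {r}
    guess-within v G (no none) n≤G G-fits = contradiction (G , n≤G , G-fits) none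

    -- By contraposition: if all deviations stay below `η`, then `G` fits its own sample, and the
    -- output is within `q` of the true value.
    far⇒deviation : ∀ {ε k} → Eventually (λ l → q ℚ.≤ seq ε l) → (G : Graphᵈᶠ d f) →
      n ≤ order (underlying G) → (x : Fin k → Vertex (underlying G)) →
      ε <ℝ ∣ calculate nearestTester (empirical (suc n) d (underlying G) x) -ℝ value ζ G ∣ℝ →
      ∃[ j ] η ℚ.≤ ℚ.∣ deviation (λ j → occurs? (underlying G) (pattern-at j)) j x ∣
    far⇒deviation {ε} q≤ε G n≤G x far = decidable-stable em λ none →
      within⇒≮ {ε} {q} {calculate nearestTester Y} {value ζ G} q≤ε
        (guess-within (restrict Y) G em n≤G (fits none)) far
      where
      Y = empirical (suc n) d (underlying G) x
      fits : ¬ (∃[ j ] η ℚ.≤ ℚ.∣ deviation (λ j → occurs? (underlying G) (pattern-at j)) j x ∣) →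
        Fits (restrict Y) (underlying G)
      fits none j = subst (λ y → ℚ.∣ y ℚ.- patternFrequency (underlying G) (pattern-at j) ∣ ℚ.≤ η)
        (sym (lookup∘tabulate (Y ∘ pattern-at) j))
        (ℚ.<⇒≤ (ℚ.≰⇒> λ η≤ → none (j , η≤)))

    sampleSize : ∀ {c} → 0ℚ ℚ.< c → ∃[ k ] (1 ≤ k × ι m ℚ.≤ ι k ℚ.* (square η ℚ.* c))
    -- `suc M` brings `square η * c` up to at least 1, and a further factor covers the `m` patterns;
    -- taking `suc m` keeps the sample nonempty even without patterns.
    sampleSize {c} c>0 = suc m ℕ.* suc M , s≤s z≤n , (begin
      ι m                         ≤⟨ subst (ι m ℚ.≤_) (sym (ι-suc m)) (subst (ℚ._≤ 1ℚ ℚ.+ ι m) (ℚ.+-identityˡ (ι m))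
                                       (ℚ.+-monoˡ-≤ (ι m) (ℚ.nonNegative⁻¹ 1ℚ))) ⟩
      ι (suc m)                   ≡⟨ ℚ.*-identityʳ (ι (suc m)) ⟨
      ι (suc m) ℚ.* 1ℚ            ≤⟨ ℚ.*-monoˡ-≤-nonNeg (ι (suc m)) {{ℚ.nonNegative (0≤ι (suc m))}} (proj₂ scale) ⟩
      ι (suc m) ℚ.* (ι (suc M) ℚ.* (square η ℚ.* c))  ≡⟨ ℚ.*-assoc (ι (suc m)) (ι (suc M)) (square η ℚ.* c) ⟨
      ι (suc m) ℚ.* ι (suc M) ℚ.* (square η ℚ.* c)    ≡⟨ cong (ℚ._* (square η ℚ.* c)) (ι-* (suc m) (suc M)) ⟨
      ι (suc m ℕ.* suc M) ℚ.* (square η ℚ.* c)        ∎)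
      where
      open ℚ.≤-Reasoning
      η>0 = ½*-pos (0<τ n)
      scale = archimedean (*-pos (*-pos η>0 η>0) c>0)
      M = proj₁ scale

    failure-unlikely : ∀ {ε k c} → Eventually (λ l → q ℚ.≤ seq ε l) → 1 ≤ k →
      ι m ℚ.≤ ι k ℚ.* (square η ℚ.* c) → (G : Graphᵈᶠ d f) → n < order (underlying G) →
      Prob {order (underlying G)} {k} (λ x → em
        {ε <ℝ ∣ calculate nearestTester (empirical (suc n) d (underlying G) x) -ℝ value ζ G ∣ℝ}) ℚ.≤ c
    failure-unlikely {ε} {k} {c} q≤ε 1≤k large G n<G = chebyshev
      {A = λ j → Occurs (underlying G) (pattern-at j)} (λ j → occurs? (underlying G) (pattern-at j))
      {E = λ x → ε <ℝ ∣ calculate nearestTester (empirical (suc n) d (underlying G) x) -ℝ value ζ G ∣ℝ}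
      (λ _ → em) {η} {c} (ℕ.≤-trans (s≤s z≤n) n<G) 1≤k (½*-pos (0<τ n)) large
      (far⇒deviation {ε} {k} q≤ε G (ℕ.<⇒≤ n<G))

-- Choice of the constants.

fromℚ<ℝ : ∀ {p q ε} → 0ℚ ℚ.< q → Eventually (λ n → q ℚ.≤ seq ε n) → p ℚ.≤ ½ ℚ.* q → fromℚ p <ℝ ε
fromℚ<ℝ {p} {q} {ε} q>0 (N , q≤ε) p≤½q = ½ ℚ.* q , ½*-pos q>0 , N , λ n N≤n → ℚ.≤-trans
  (subst (p ℚ.+ ½ ℚ.* q ℚ.≤_) (½+½ q) (ℚ.+-monoˡ-≤ (½ ℚ.* q) p≤½q)) (q≤ε n N≤n)

theorem3 : (em : ExcludedMiddle 0ℓ) →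
    (d : ℕ) → 2 ≤ d →
    (f : ℕ → ℕ) → Subexponential f →
    (ζ : Parameter d f) → Continuous ζ → Testable em ζ
theorem3 em d _ f _ ζ continuous ε ε>0 =
  let q , q>0 , q≤ε = positive-below ε ε>0
      n , ζ-modulus = modulus em ζ continuous q>0
      -- The failure bound is half of `q`, leaving the other half as the margin for strict
      -- inequality with `ε`.
      k , 1≤k , large = sampleSize em ζ n ζ-modulus (½*-pos q>0)
  -- The threshold `suc n` makes `G` nonempty, as Chebyshev's inequality requires; the radius
  -- `suc n` is positive even when `n` is 0.
  in suc n , suc n , k , s≤s z≤n , s≤s z≤n , 1≤k , nearestTester em ζ n , λ G n<G →
    fromℚ<ℝ {q = q} {ε} q>0 q≤ε
      (failure-unlikely em ζ n ζ-modulus {ε} {k} {½ ℚ.* q} q≤ε 1≤k large G n<G)
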